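{- Let $G=(V,E)$ be a signed graph with $E=E_+\sqcup E_-$. Then $G$ is signed-eliminable if and only if all of the following three conditions hold: (C1) Both $G_+$ and $G_-$ are chordal. (C2) For every $\sigma\in\{+,-\}$ and every four distinct vertices $u,v,w,x$ of $G$ with $uv\in E_\sigma$, $vw\in E_{ -\sigma}$, $wx\in E_\sigma$, we have either ($uw\in E_\sigma$ and $ux\in E_\sigma$) or ($ux\in E_\sigma$ and $vx\in E_\sigma$). (C3) $G$ contains no mountain and no hill as an induced subgraph.
   Context: All graphs are finite, simple and undirected. A signed graph is a graph $G=(V,E)$ together with a partition $E=E_+\sqcup E_-$ (either part may be empty); put $G_\sigma=(V,E_\sigma)$ for $\sigma\in\{+,-\}$, and let $-\sigma$ be the opposite sign. Induced subgraphs of a signed graph inherit the signs. A graph is chordal if it has no induced cycle of length at least four. An ordering on $G$ is a bijection $\nu:V\to\{1,\dots,|V|\}$. It is a signed elimination ordering (SEO) if for every triple $(u,v,w)$ of distinct vertices with $\nu(u)<\nu(w)>\nu(v)$ and each $\sigma\in\{+,-\}$: (E1) if $uw,wv\in E_\sigma$ then $uv\in E_\sigma$; (E2) if $uv\in E_\sigma$ and $vw\in E_{ -\sigma}$ then $uw\in E_\sigma$. $G$ is signed-eliminable if it admits a SEO. A mountain is a signed graph for which there are $\sigma\in\{+,-\}$ and an enumeration $(v_1,\dots,v_n;w)$ of its (distinct) vertices, $n\ge 3$, such that $v_iv_{i+1}\in E_{ -\sigma}$ for $1\le i\le n-1$, $wv_i\in E_\sigma$ for $2\le i\le n-1$, and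 no other pair of vertices is joined by an edge. A hill is a signed graph for which there are $\sigma\in\{+,-\}$ and an enumeration $(v_1,\dots,v_n;w_1,w_2)$ of its (distinct) vertices, $n\ge 2$, such that $v_iv_{i+1}\in E_{ -\sigma}$ for $1\le i\le n-1$, $w_1w_2\in E_\sigma$, $w_1v_i\in E_\sigma$ for $1\le i\le n-1$, $w_2v_i\in E_\sigma$ for $2\le i\le n$, and no other pair of vertices is joined by an edge. -}

module Defs where

open import Data.Fin.Base using (Fin; toℕ; _<_)
open import Data.Fin.Patterns using (0F; 1F)
open import Data.Fin.Permutation using (Permutation′; _⟨$⟩ʳ_)
open import Data.List.Base using ([]; _∷_)
open import Data.List.Relation.Unary.Unique.Propositional using (Unique)
open import Data.Maybe.Base using (Maybe; just; nothing)
open import Data.Maybe.Properties using (≡-dec)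
open import Data.Nat.Base as ℕ using (ℕ; suc)
import Data.Nat.Properties as ℕ
open import Data.Product.Base using (∃; _×_; _,_)
open import Data.Sign.Base using (Sign; opposite)
import Data.Sign.Properties as Sign
open import Data.Sum.Base using (_⊎_; inj₁; inj₂; swap)
open import Data.Unit.Base using (⊤; tt)
open import Function.Bundles using (_⇔_; _↔_; module Inverse)
open import Function.Definitions using (Injective)
open import Level using (0ℓ)
open import Relation.Binary.Core using (Rel)
open import Relation.Binary.Definitions using (Decidable; Symmetric)
open import Relation.Binary.PropositionalEquality using (_≡_; sym; trans; cong)
open import Relation.Nullary using (¬_)
open import Relation.Nullary.Decidable using (_×-dec_; _⊎-dec_)

private
  variable
    k m n : ℕ

record Graph (n : ℕ) : Set₁ where
  field
    Adj    : Rel (Fin n) 0ℓ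
    adj?   : Decidable Adj
    symm   : Symmetric Adj
    irrefl : ∀ u → ¬ Adj u u

-- The pairs of positions (i , i + 1).
Next : Rel (Fin n) 0ℓ
Next i j = toℕ j ≡ suc (toℕ i)

CyclicNext : Rel (Fin n) 0ℓ
CyclicNext {n} i j = Next i j ⊎ (suc (toℕ i) ≡ n × toℕ j ≡ 0)

cycle : 3 ℕ.≤ k → Graph k
cycle {k} 3≤k = record
  { Adj    = λ i j → CyclicNext i j ⊎ CyclicNext j i
  ; adj?   = λ i j → next? i j ⊎-dec next? j i
  ; symm   = swap
  ; irrefl = λ { i (inj₁ p) → irr i p ; i (inj₂ p) → irr i p }
  }
  where
  next? : Decidable (CyclicNext {k})
  next? i j = (toℕ j ℕ.≟ suc (toℕ i))
        ⊎-dec ((suc (toℕ i) ℕ.≟ k) ×-dec (toℕ j ℕ.≟ 0))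

  irr : ∀ i → ¬ CyclicNext {k} i i
  irr i (inj₁ p)       = ℕ.1+n≢n (sym p)
  irr i (inj₂ (p , q)) =
    ℕ.<⇒≢ (ℕ.≤-trans (ℕ.n≤1+n 2) 3≤k) (trans (cong suc (sym q)) p)

-- H is isomorphic to an induced subgraph of G.
record InducedIn (H : Graph m) (G : Graph n) : Set where
  field
    embed     : Fin m → Fin n
    injective : Injective _≡_ _≡_ embed
    adj⇔      : ∀ i j → Graph.Adj H i j ⇔ Graph.Adj G (embed i) (embed j)

Chordal : Graph n → Set
Chordal G = ∀ {k} (3<k : 3 ℕ.< k) → ¬ InducedIn (cycle (ℕ.<⇒≤ 3<k)) G

-- The edge set together with its partition into E₊ and E₋ is given by the
-- map `sign`: the value `nothing` marks a non-edge, and `just σ` an edge in E_σ.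
record SignedGraph (n : ℕ) : Set where
  field
    sign        : Fin n → Fin n → Maybe Sign
    sign-symm   : ∀ u v → sign u v ≡ sign v u
    sign-irrefl : ∀ u → sign u u ≡ nothing

  E : Sign → Rel (Fin n) 0ℓ
  E σ u v = sign u v ≡ just σ

  Joined : Rel (Fin n) 0ℓ
  Joined u v = ∃ λ σ → E σ u v

  part : Sign → Graph n
  part σ = record
    { Adj    = E σ
    ; adj?   = λ u v → ≡-dec Sign._≟_ (sign u v) (just σ)
    ; symm   = λ {u} {v} p → trans (sign-symm v u) p
    ; irrefl = λ u p → nothing≢just (trans (sym (sign-irrefl u)) p)
    }
    where
    nothing≢just : ¬ nothing ≡ just σ
    nothing≢just ()

-- H is isomorphic, signs included, to an induced subgraph of G.
record SignedInducedIn (H : SignedGraph m) (G : SignedGraph n) : Set where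
  field
    embed     : Fin m → Fin n
    injective : Injective _≡_ _≡_ embed
    sign≡     : ∀ i j → SignedGraph.sign G (embed i) (embed j) ≡ SignedGraph.sign H i j

-- Orderings take values in {0,…,n-1} rather than {1,…,n}; only the order of
-- the values matters.
record IsSEO (G : SignedGraph n) (ν : Permutation′ n) : Set where
  open SignedGraph G
  field
    E1 : ∀ u v w → Unique (u ∷ v ∷ w ∷ []) →
         ν ⟨$⟩ʳ u < ν ⟨$⟩ʳ w → ν ⟨$⟩ʳ v < ν ⟨$⟩ʳ w →
         ∀ σ → E σ u w → E σ w v → E σ u v
    E2 : ∀ u v w → Unique (u ∷ v ∷ w ∷ []) →
         ν ⟨$⟩ʳ u < ν ⟨$⟩ʳ w → ν ⟨$⟩ʳ v < ν ⟨$⟩ʳ w →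
         ∀ σ → E σ u v → E (opposite σ) v w → E σ u w

SignedEliminable : SignedGraph n → Set
SignedEliminable G = ∃ λ ν → IsSEO G ν

NotFirst NotLast : Fin n → Set
NotFirst i    = 0 ℕ.< toℕ i
NotLast {n} i = suc (toℕ i) ℕ.< n

-- In the next two records the path v₁,…,vₙ (n = len) is indexed from 0, and the
-- `only` fields together say that no further pair of vertices is joined by an edge.
record Mountain (G : SignedGraph m) : Set where
  open SignedGraph G
  field
    σ     : Sign
    len   : ℕ
    3≤len : 3 ℕ.≤ len
    enum  : (Fin len ⊎ ⊤) ↔ Fin m

  v : Fin len → Fin m
  v i = Inverse.to enum (inj₁ i)

  w : Fin m
  w = Inverse.to enum (inj₂ tt)

  field
    path      : ∀ i j → Next i j → E (opposite σ) (v i) (v j)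
    path-only : ∀ i j → Joined (v i) (v j) → Next i j ⊎ Next j i
    w-edge    : ∀ i → NotFirst i → NotLast i → E σ w (v i)
    w-only    : ∀ i → Joined w (v i) → NotFirst i × NotLast i

record Hill (G : SignedGraph m) : Set where
  open SignedGraph G
  field
    σ     : Sign
    len   : ℕ
    2≤len : 2 ℕ.≤ len
    enum  : (Fin len ⊎ Fin 2) ↔ Fin m

  v : Fin len → Fin m
  v i = Inverse.to enum (inj₁ i)

  w₁ : Fin m
  w₁ = Inverse.to enum (inj₂ 0F)

  w₂ : Fin m
  w₂ = Inverse.to enum (inj₂ 1F)

  field
    path      : ∀ i j → Next i j → E (opposite σ) (v i) (v j)
    path-only : ∀ i j → Joined (v i) (v j) → Next i j ⊎ Next j i
    w₁w₂-edge : E σ w₁ w₂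
    w₁-edge   : ∀ i → NotLast i → E σ w₁ (v i)
    w₁-only   : ∀ i → Joined w₁ (v i) → NotLast i
    w₂-edge   : ∀ i → NotFirst i → E σ w₂ (v i)
    w₂-only   : ∀ i → Joined w₂ (v i) → NotFirst i

C1 : SignedGraph n → Set
C1 G = Chordal (part Sign.+) × Chordal (part Sign.-)
  where open SignedGraph G

C2 : SignedGraph n → Set
C2 G = ∀ σ u v w x → Unique (u ∷ v ∷ w ∷ x ∷ []) →
       E σ u v → E (opposite σ) v w → E σ w x →
       (E σ u w × E σ u x) ⊎ (E σ u x × E σ v x)
  where open SignedGraph G

C3 : SignedGraph n → Set
C3 G = ∀ {m} (H : SignedGraph m) → SignedInducedIn H G → ¬ Mountain H × ¬ Hill H

{-# OPTIONS --safe #-}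
module Submission where

-- Write N_σ(x) for the σ-neighbours of x. By (C2) the sets N_σ(x) and N_σ(y) are
-- nested whenever xy is an edge of the opposite sign τ; call the step from x to y
-- upward if N_σ(x) ⊆ N_σ(y). An upward τ-step followed by an upward σ-step is
-- again an upward τ-step, strictly so; hence upward cycles have a single sign, and
-- a strongly connected class of vertices that no upward step leaves is either a
-- single vertex, strictly above all its neighbours, or a set K joined by τ-edges
-- on which N_σ is constant. As mountains and hills are excluded, the τ-neighbours
-- of such a class outside it form a τ-clique, so by Dirac's argument for chordal
-- graphs K contains a vertex that is simplicial in G_τ. That vertex can be put
-- last, and induction on the number of vertices gives an SEO. Conversely the last
-- vertex of an induced subgraph in an SEO can be put last there too, and no
-- forbidden configuration has such a vertex.

open import Defs
open import Data.Empty using (⊥; ⊥-elim)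
open import Data.Fin.Base using (Fin; zero; suc; toℕ; fromℕ; fromℕ<; inject₁; punchIn; _<_)
open import Data.Fin.Patterns using (0F; 1F; 2F; 3F)
open import Data.Fin.Permutation as Permutation
  using (Permutation; Permutation′; _⟨$⟩ʳ_; _⟨$⟩ˡ_; insert; insert-punchIn)
open import Data.Fin.Properties
  using ( _≟_; any?; all?; ¬∀⟶∃¬; suc-injective; +↔⊎; 1↔⊤
        ; toℕ-injective; toℕ-fromℕ; toℕ-fromℕ<; toℕ-inject₁; toℕ<n; ≤fromℕ
        ; punchIn-injective; punchIn-punchOut; punchIn-mono-≤ )
open import Data.Fin.Subset using (Subset; _∈_; _⊂_; _∪_; ⁅_⁆)
open import Data.Fin.Subset.Induction using (⊂-wellFounded; ⊃-wellFounded; Acc; acc)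
open import Data.Fin.Subset.Properties
  using (_∈?_; x∈⁅x⁆; x∈⁅y⁆⇒x≡y; x∈p∪q⁺; x∈p∪q⁻; p⊆p∪q)
open import Data.List.Base using (List; []; _∷_; lookup)
open import Data.List.Membership.Propositional.Properties using (∈-lookup)
open import Data.List.Relation.Unary.All as All using ([]; _∷_)
open import Data.List.Relation.Unary.AllPairs using ([]; _∷_)
open import Data.List.Relation.Unary.Unique.Propositional using (Unique)
import Data.List.Relation.Unary.Unique.Propositional.Properties as Unique
open import Data.Maybe.Properties using (just-injective)
open import Data.Nat.Base as ℕ using (ℕ; zero; suc; _≤_; z≤n; s≤s)
import Data.Nat.Properties as ℕ
open import Data.Product.Base using (∃; ∃₂; _×_; _,_; proj₁; proj₂)
open import Data.Sign.Base using (Sign; opposite)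
import Data.Sign.Properties as Sign
open import Data.Sum.Base as Sum using (_⊎_; inj₁; inj₂; [_,_]′)
open import Data.Sum.Function.Propositional using (_⊎-↔_)
open import Data.Sum.Properties using (inj₁-injective)
open import Data.Unit.Base using (⊤; tt)
open import Data.Vec.Base using (tabulate)
open import Data.Vec.Properties using (lookup∘tabulate; []=⇒lookup; lookup⇒[]=)
open import Function.Base using (_∘_; case_of_)
open import Function.Bundles using (_⇔_; mk⇔; _↔_; Equivalence; Injection; module Inverse)
open import Function.Construct.Composition using (_↔-∘_)
open import Function.Construct.Identity using (↔-id)
open import Function.Construct.Symmetry using (↔-sym)
open import Function.Definitions using (Injective)
open import Function.Properties.Inverse using (↔⇒↣)
open import Level using (0ℓ)
open import Relation.Binary.Construct.Closure.ReflexiveTransitive as Star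
  using (Star; ε; _◅_; _◅◅_)
open import Relation.Binary.Core using (Rel)
open import Relation.Binary.Definitions using (Decidable)
open import Relation.Binary.PropositionalEquality
  using (_≡_; _≢_; refl; sym; trans; cong; cong₂; subst; subst₂)
open import Relation.Nullary using (¬_; Dec; yes; no; contradiction)
open import Relation.Nullary.Decidable
  using (does; dec-true; _×-dec_; _⊎-dec_; _→-dec_; ¬?; decidable-stable)
import Relation.Unary as U

private
  variable
    k m n : ℕ

-- Finite sets and reachability

⟦_⟧ : {P : Fin n → Set} → U.Decidable P → Subset n
⟦ P? ⟧ = tabulate (λ i → does (P? i))

∈⟦⟧⁺ : {P : Fin n → Set} (P? : U.Decidable P) → ∀ {i} → P i → i ∈ ⟦ P? ⟧
∈⟦⟧⁺ P? {i} p = lookup⇒[]= i _ (trans (lookup∘tabulate _ i) (dec-true (P? i) p))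

∈⟦⟧⁻ : {P : Fin n → Set} (P? : U.Decidable P) → ∀ {i} → i ∈ ⟦ P? ⟧ → P i
∈⟦⟧⁻ P? {i} i∈ with P? i | trans (sym (lookup∘tabulate (λ j → does (P? j)) i)) ([]=⇒lookup i∈)
... | yes p | _  = p
... | no  _ | ()

module _ {R : Rel (Fin n) 0ℓ} (R? : Decidable R) where

  -- The steps of `walk` keep both ends in `set`, so the set is connected as an induced subgraph
  -- once `R` is made symmetric.
  record Reach (r : Fin n) : Set where
    field
      set     : Subset n
      root    : r ∈ set
      closed  : ∀ {a b} → a ∈ set → R a b → b ∈ set
      walk    : ∀ {a} → a ∈ set → Star (λ x y → R x y × x ∈ set × y ∈ set) r a

    star : ∀ {a} → a ∈ set → Star R r a
    star a∈ = Star.map proj₁ (walk a∈)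

    star⁻ : ∀ {a b} → a ∈ set → Star R a b → b ∈ set
    star⁻ a∈ ε        = a∈
    star⁻ a∈ (s ◅ ss) = star⁻ (closed a∈ s) ss

  abstract
    -- As long as some step leaves `S`, its target is added; the sets grow strictly, so this stops.
    reach : ∀ r → Reach r
    reach r = grow ⁅ r ⁆ (⊃-wellFounded _) (x∈⁅x⁆ r)
                λ a∈ → subst (Star _ r) (sym (x∈⁅y⁆⇒x≡y r a∈)) ε
      where
      grow : ∀ S → Acc (λ p q → q ⊂ p) S → r ∈ S →
             (∀ {a} → a ∈ S → Star (λ x y → R x y × x ∈ S × y ∈ S) r a) → Reach r
      grow S (acc rec) r∈ w
        with any? (λ a → any? (λ b → a ∈? S ×-dec R? a b ×-dec ¬? (b ∈? S)))
      ... | no none = record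
        { set = S ; root = r∈ ; walk = w
        ; closed = λ {a} {b} a∈ s →
            decidable-stable (b ∈? S) λ b∉ → none (a , b , a∈ , s , b∉) }
      ... | yes (a , b , a∈ , s , b∉) =
        grow (S ∪ ⁅ b ⁆) (rec (old , b , new , b∉)) (old r∈) λ {c} c∈ →
          case x∈p∪q⁻ S ⁅ b ⁆ c∈ of λ where
            (inj₁ c∈S) → lift (w c∈S)
            (inj₂ c∈b) → subst (Star _ r) (sym (x∈⁅y⁆⇒x≡y b c∈b))
                           (lift (w a∈) ◅◅ ((s , old a∈ , new) ◅ ε))
        where
        old : ∀ {c} → c ∈ S → c ∈ S ∪ ⁅ b ⁆
        old = p⊆p∪q ⁅ b ⁆
        new : b ∈ S ∪ ⁅ b ⁆
        new = x∈p∪q⁺ (inj₂ (x∈⁅x⁆ b))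
        lift : ∀ {c} → Star (λ x y → R x y × x ∈ S × y ∈ S) r c →
               Star (λ x y → R x y × x ∈ S ∪ ⁅ b ⁆ × y ∈ S ∪ ⁅ b ⁆) r c
        lift = Star.map λ (s , p , q) → s , old p , old q

  -- These are the vertices of the sink components of the digraph `R`.
  Terminal : Fin n → Set
  Terminal x = ∀ {y} → Star R x y → Star R y x

  -- If `x` leads to `y` but not back, the set reached from `y` lies in the one reached from `x` and
  -- misses `x`, so moving on to `y` shrinks it strictly.
  ∃-terminal : Fin n → ∃ Terminal
  ∃-terminal x₀ = go x₀ (⊂-wellFounded _)
    where
    open Reach
    go : ∀ x → Acc _⊂_ (set (reach x)) → ∃ Terminal
    go x (acc rec) with any? (λ y → y ∈? set (reach x) ×-dec ¬? (x ∈? set (reach y)))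
    ... | no none = x , λ {y} s → star (reach y) (decidable-stable (x ∈? _)
                      λ x∉ → none (y , star⁻ (reach x) (root (reach x)) s , x∉))
    ... | yes (y , y∈ , x∉) = go y (rec
      ( (λ z∈ → star⁻ (reach x) (root (reach x)) (star (reach x) y∈ ◅◅ star (reach y) z∈))
      , x , root (reach x) , x∉))

argmax : (f : Fin (suc m) → ℕ) → ∃ λ i → ∀ j → f j ≤ f i
argmax {zero}  f = zero , λ { zero → ℕ.≤-refl }
argmax {suc m} f with argmax (f ∘ suc)
... | i , max with ℕ.≤-total (f zero) (f (suc i))
...   | inj₁ le = suc i , λ { zero → le ; (suc j) → max j }
...   | inj₂ ge = zero , λ { zero → ℕ.≤-refl ; (suc j) → ℕ.≤-trans (max j) ge }

-- Induced paths

module _ (H : Graph n) where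
  open Graph H

  private
    variable
      A B : Fin n → Set
      a b s t : Fin n

    adj-≢ : Adj a b → a ≢ b
    adj-≢ {a} ab refl = irrefl a ab

  record IsPath (v : Fin (suc k) → Fin n) : Set where
    field
      next : ∀ {i j} → Next i j → Adj (v i) (v j)
      only : ∀ {i j} → Adj (v i) (v j) → Next i j ⊎ Next j i
      inj  : ∀ {i j} → v i ≡ v j → i ≡ j

  record Path (B : Fin n → Set) (s t : Fin n) : Set where
    field
      {last} : ℕ
      v      : Fin (suc last) → Fin n
      isPath : IsPath v
      start  : v zero ≡ s
      end    : v (fromℕ last) ≡ t
      inside : ∀ i → B (v i)
    open IsPath isPath public

  mapPath : (∀ {x} → A x → B x) → Path A s t → Path B s t
  mapPath f p = record { Path p ; inside = f ∘ Path.inside p }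

  trivial : B t → Path B t t
  trivial {t = t} bt = record
    { last = 0 ; v = λ _ → t ; start = refl ; end = refl ; inside = λ _ → bt
    ; isPath = record
      { next = λ { {zero} {zero} () }
      ; only = λ tt → contradiction tt (irrefl t)
      ; inj  = λ { {zero} {zero} _ → refl } } }

  tail : (p : Path B s t) → ∀ {l} → Path.last p ≡ suc l → ∃ λ s′ → Path B s′ t
  tail p refl = v (suc zero) , record
    { v = v ∘ suc ; start = refl ; end = end ; inside = inside ∘ suc
    ; isPath = record
      { next = λ e → next (cong suc e)
      ; only = λ e → Sum.map ℕ.suc-injective ℕ.suc-injective (only e)
      ; inj  = suc-injective ∘ inj } }
    where open Path p

  prepend : B a → (p : Path B s t) → Adj a s → (∀ i → a ≢ Path.v p i) →
            (∀ i → ¬ Adj a (Path.v p (suc i))) → Path B a t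
  prepend {B = B} {a} Ba p as a∉ ¬adj = record
    { v = v′ ; start = refl ; end = end ; inside = inside′
    ; isPath = record { next = next′ ; only = only′ ; inj = inj′ } }
    where
    open Path p
    v′ : Fin (suc (suc last)) → Fin n
    v′ zero    = a
    v′ (suc i) = v i
    inside′ : ∀ i → B (v′ i)
    inside′ zero    = Ba
    inside′ (suc i) = inside i
    next′ : ∀ {i j} → Next i j → Adj (v′ i) (v′ j)
    next′ {zero}  {suc zero} _ = subst (Adj a) (sym start) as
    next′ {suc i} {suc j}    e = next (ℕ.suc-injective e)
    only₀ : ∀ j → Adj a (v j) → toℕ j ≡ 0
    only₀ zero    _ = refl
    only₀ (suc j) e = contradiction e (¬adj j)
    only′ : ∀ {i j} → Adj (v′ i) (v′ j) → Next i j ⊎ Next j i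
    only′ {zero}  {zero}  e = contradiction e (irrefl a)
    only′ {zero}  {suc j} e = inj₁ (cong suc (only₀ j e))
    only′ {suc i} {zero}  e = inj₂ (cong suc (only₀ i (symm e)))
    only′ {suc i} {suc j} e = Sum.map (cong suc) (cong suc) (only e)
    inj′ : ∀ {i j} → v′ i ≡ v′ j → i ≡ j
    inj′ {zero}  {zero}  e = refl
    inj′ {zero}  {suc j} e = contradiction e (a∉ j)
    inj′ {suc i} {zero}  e = contradiction (sym e) (a∉ i)
    inj′ {suc i} {suc j} e = cong suc (inj e)

  -- Shortcutting through the last vertex of p related to a keeps the path induced.
  extend : B a → (p : Path B s t) → (∃ λ i → a ≡ Path.v p i ⊎ Adj a (Path.v p i)) → Path B a t
  extend {B = B} {a} {t = t} Ba p = go _ p refl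
    where
    go : ∀ l {s} (p : Path B s t) → Path.last p ≡ l →
         (∃ λ i → a ≡ Path.v p i ⊎ Adj a (Path.v p i)) → Path B a t
    go zero p refl (zero , inj₁ refl) = record { Path p ; start = refl }
    go zero p refl (zero , inj₂ e)    =
      prepend Ba p (subst (Adj a) (Path.start p) e) (λ { zero → adj-≢ e }) λ ()
    go (suc l) p refl (i , e)
      with any? (λ j → (a ≟ Path.v p (suc j)) ⊎-dec adj? a (Path.v p (suc j)))
    go (suc l) p refl (i , e)            | yes r  = go l (proj₂ (tail p refl)) refl r
    go (suc l) p refl (zero , inj₁ refl) | no  _  = record { Path p ; start = refl }
    go (suc l) p refl (zero , inj₂ e)    | no  ¬r =
      prepend Ba p (subst (Adj a) (Path.start p) e)
        (λ { zero → adj-≢ e ; (suc j) a≡ → ¬r (j , inj₁ a≡) })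
        (λ j e′ → ¬r (j , inj₂ e′))
    go (suc l) p refl (suc i , e)        | no  ¬r = contradiction (i , e) ¬r

  -- The ends are located by equations on positions, so `len` can be arbitrary and the three-way
  -- split by `position` applies directly.
  record Chain (A : Fin n → Set) (s t : Fin n) : Set where
    field
      len      : ℕ
      3≤len    : 3 ≤ len
      v        : Fin len → Fin n
      first    : ∀ i → toℕ i ≡ 0 → v i ≡ s
      final    : ∀ i → suc (toℕ i) ≡ len → v i ≡ t
      interior : ∀ i → NotFirst i → NotLast i → A (v i)
      next     : ∀ {i j} → Next i j → Adj (v i) (v j)
      only     : ∀ {i j} → Adj (v i) (v j) → Next i j ⊎ Next j i
      inj      : ∀ {i j} → v i ≡ v j → i ≡ j

  Connected : (Fin n → Set) → Set
  Connected A = ∀ {a b} → A a → A b → Star (λ x y → Adj x y × A x × A y) a b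

  length-≥3 : (p : Path B s t) → s ≢ t → ¬ Adj s t → 3 ≤ suc (Path.last p)
  length-≥3 record { last = zero ; start = s ; end = e } s≢t _ = contradiction (trans (sym s) e) s≢t
  length-≥3 record { last = suc zero ; start = s ; end = e ; isPath = p } _ ¬st =
    contradiction (subst₂ Adj s e (IsPath.next p refl)) ¬st
  length-≥3 record { last = suc (suc _) } _ _ = s≤s (s≤s (s≤s z≤n))

  -- The path starts as `t` alone and grows backwards along a walk from `a` to `b`, then by `s`;
  -- `extend` keeps it induced throughout. An induced path repeats no vertex, so its interior avoids
  -- `s` and `t` and lies in `A`.
  chain : Connected A → ¬ A s → ¬ A t → s ≢ t → ¬ Adj s t →
          A a → Adj s a → A b → Adj t b → Chain A s t
  chain {A = A} {s} {t} {a} {b} conn s∉ t∉ s≢t ¬st Aa sa Ab tb = record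
    { len = suc last
    ; 3≤len = length-≥3 p s≢t ¬st
    ; v = v ; first = first ; final = final ; interior = interior
    ; next = next ; only = only ; inj = inj }
    where
    C : Fin n → Set
    C x = A x ⊎ x ≡ t
    walk : ∀ {x} → Star (λ x y → Adj x y × A x × A y) x b → A x → Path C x t
    walk ε Ax = extend (inj₁ Ax) (trivial (inj₂ refl)) (zero , inj₂ (symm tb))
    walk ((xy , _ , Ay) ◅ w) Ax =
      let p = walk w Ay in
      extend (inj₁ Ax) p (zero , inj₂ (subst (Adj _) (sym (Path.start p)) xy))
    tour : Path C a t
    tour = walk (conn Aa Ab) Aa
    p : Path (λ x → C x ⊎ x ≡ s) s t
    p = extend (inj₂ refl) (mapPath inj₁ tour)
          (zero , inj₂ (subst (Adj s) (sym (Path.start tour)) sa))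
    open Path p
    first : ∀ i → toℕ i ≡ 0 → v i ≡ s
    first zero _ = start
    final : ∀ i → suc (toℕ i) ≡ suc last → v i ≡ t
    final i e = trans (cong v (toℕ-injective
                  (trans (ℕ.suc-injective e) (sym (toℕ-fromℕ last))))) end
    interior : ∀ i → NotFirst i → NotLast i → A (v i)
    interior i 0<i i<l with inside i
    ... | inj₁ (inj₁ Ai) = Ai
    ... | inj₁ (inj₂ ≡t) = contradiction
      (trans (cong (suc ∘ toℕ) (inj (trans ≡t (sym end)))) (cong suc (toℕ-fromℕ last)))
      (ℕ.<⇒≢ i<l)
    ... | inj₂ ≡s = contradiction (sym (cong toℕ (inj (trans ≡s (sym start))))) (ℕ.<⇒≢ 0<i)

-- Chordal graphs

position : ∀ (i : Fin k) → toℕ i ≡ 0 ⊎ suc (toℕ i) ≡ k ⊎ (NotFirst i × NotLast i)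
position {k} i with toℕ i ℕ.≟ 0 | suc (toℕ i) ℕ.≟ k
... | yes p | _     = inj₁ p
... | no  _ | yes q = inj₂ (inj₁ q)
... | no  p | no  q = inj₂ (inj₂ (ℕ.n≢0⇒n>0 p , ℕ.≤∧≢⇒< (toℕ<n i) q))

module _ (H : Graph n) where
  open Graph H

  Clique : (Fin n → Set) → Set
  Clique A = ∀ {a b} → A a → A b → a ≢ b → Adj a b

  Boundary : (Fin n → Set) → Fin n → Set
  Boundary A y = ¬ A y × ∃ λ a → A a × Adj a y

module _ (H : Graph n) (chordal : Chordal H) where
  open Graph H

  private
    variable
      A : Fin n → Set
      s t x : Fin n

  -- Adding `x` closes the chain to an induced cycle on `suc len` vertices, at least four because
  -- `3 ≤ len`.
  no-apex : (c : Chain H A s t) → Adj x s → Adj x t → ¬ A x → (∀ {a} → A a → ¬ Adj x a) → ⊥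
  no-apex {A = A} {s} {t} {x} c xs xt x∉ ¬xA = chordal (s≤s 3≤len) record
    { embed = f ; injective = f-inj ; adj⇔ = λ i j → mk⇔ (to i j) (from i j) }
    where
    open Chain c
    f : Fin (suc len) → Fin n
    f zero    = x
    f (suc i) = v i
    x∉v : ∀ i → x ≢ v i
    x∉v i x≡ with position i
    ... | inj₁ p               = irrefl x (subst (Adj x) (sym (trans x≡ (first i p))) xs)
    ... | inj₂ (inj₁ p)        = irrefl x (subst (Adj x) (sym (trans x≡ (final i p))) xt)
    ... | inj₂ (inj₂ (p , q))  = x∉ (subst A (sym x≡) (interior i p q))
    f-inj : ∀ {i j} → f i ≡ f j → i ≡ j
    f-inj {zero}  {zero}  e = refl
    f-inj {zero}  {suc j} e = contradiction e (x∉v j)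
    f-inj {suc i} {zero}  e = contradiction (sym e) (x∉v i)
    f-inj {suc i} {suc j} e = cong suc (inj e)
    C : Rel (Fin (suc len)) 0ℓ
    C = Graph.Adj (cycle (ℕ.<⇒≤ (s≤s 3≤len)))
    apex⁺ : ∀ j → C zero (suc j) → Adj x (v j)
    apex⁺ j (inj₁ (inj₁ p))       = subst (Adj x) (sym (first j (ℕ.suc-injective p))) xs
    apex⁺ j (inj₂ (inj₂ (p , _))) = subst (Adj x) (sym (final j (ℕ.suc-injective p))) xt
    apex⁻ : ∀ j → Adj x (v j) → C zero (suc j)
    apex⁻ j e with position j
    ... | inj₁ p              = inj₁ (inj₁ (cong suc p))
    ... | inj₂ (inj₁ p)       = inj₂ (inj₂ (cong suc p , refl))
    ... | inj₂ (inj₂ (p , q)) = contradiction e (¬xA (interior j p q))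
    to : ∀ i j → C i j → Adj (f i) (f j)
    to zero    zero    c = contradiction c (Graph.irrefl (cycle (ℕ.<⇒≤ (s≤s 3≤len))) zero)
    to zero    (suc j) c = apex⁺ j c
    to (suc i) zero    c = symm (apex⁺ i (Sum.swap c))
    to (suc i) (suc j) (inj₁ (inj₁ p)) = next (ℕ.suc-injective p)
    to (suc i) (suc j) (inj₂ (inj₁ p)) = symm (next (ℕ.suc-injective p))
    from : ∀ i j → Adj (f i) (f j) → C i j
    from zero    zero    e = contradiction e (irrefl x)
    from zero    (suc j) e = apex⁻ j e
    from (suc i) zero    e = Sum.swap (apex⁻ i (symm e))
    from (suc i) (suc j) e = Sum.map (inj₁ ∘ cong suc) (inj₁ ∘ cong suc) (only e)

  -- Induction on `K`. If the chosen `w` has nonadjacent neighbours `u` and `v`, the component `A`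
  -- of `u` away from `v` and its neighbours has a clique as boundary. One side of this separator
  -- misses the boundary of `K`; the part of `K` on that side is nonempty, omits `w` and again has a
  -- clique as boundary.
  ∃-simplicial : ∀ (K : Subset n) → ∃ (_∈ K) → Clique H (Boundary H (_∈ K)) →
                 ∃ λ w → w ∈ K × Clique H (Adj w)
  ∃-simplicial K = go K (⊂-wellFounded K)
    where
    go : ∀ K → Acc _⊂_ K → ∃ (_∈ K) → Clique H (Boundary H (_∈ K)) →
         ∃ λ w → w ∈ K × Clique H (Adj w)
    go K (acc rec) (w , w∈) ∂K
      with any? (λ u → any? (λ v → adj? w u ×-dec adj? w v ×-dec ¬? (u ≟ v) ×-dec ¬? (adj? u v)))
    ... | no none = w , w∈ , λ {u} {v} wu wv u≢v →
      decidable-stable (adj? u v) λ ¬uv → none (u , v , wu , wv , u≢v , ¬uv)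
    ... | yes (u , v , wu , wv , u≢v , ¬uv) =
      smaller (any? λ q → boundary? q ×-dec D? q)
      where
      Step : Rel (Fin n) 0ℓ
      Step a b = Adj a b × ¬ Adj v b × b ≢ v
      step? : Decidable Step
      step? a b = adj? a b ×-dec ¬? (adj? v b) ×-dec ¬? (b ≟ v)
      module A = Reach (reach step? u)
      A? : U.Decidable (_∈ A.set)
      A? = _∈? A.set
      avoids : ∀ {a} → a ∈ A.set → ¬ Adj v a × a ≢ v
      avoids = along (¬uv ∘ symm , u≢v) ∘ A.star
        where
        along : ∀ {a b} → ¬ Adj v a × a ≢ v → Star Step a b → ¬ Adj v b × b ≢ v
        along p ε              = p
        along _ ((_ , q) ◅ ss) = along q ss
      connected : Connected H (_∈ A.set)
      connected a∈ b∈ = Star.reverse flip (walk a∈) ◅◅ walk b∈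
        where
        walk : ∀ {a} → a ∈ A.set → Star (λ x y → Adj x y × x ∈ A.set × y ∈ A.set) u a
        walk = Star.map (λ ((e , _) , p) → e , p) ∘ A.walk
        flip : ∀ {x y} → Adj x y × x ∈ A.set × y ∈ A.set → Adj y x × y ∈ A.set × x ∈ A.set
        flip (e , p , q) = symm e , q , p
      -- A boundary vertex not adjacent to `v` would have been reached; it cannot be `v` itself,
      -- since no vertex of `A` is adjacent to `v`.
      ∂A : ∀ {s} → Boundary H (_∈ A.set) s → Adj v s
      ∂A {s} (s∉ , a , a∈ , as) with adj? v s
      ... | yes vs = vs
      ... | no ¬vs = contradiction (A.closed a∈ (as , ¬vs , λ { refl → proj₁ (avoids a∈) (symm as) })) s∉
      -- Two nonadjacent boundary vertices would be the ends of a chain through `A` with apex `v`.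
      ∂A-clique : Clique H (Boundary H (_∈ A.set))
      ∂A-clique {s} {t} S@(s∉ , a , a∈ , as) T@(t∉ , b , b∈ , bt) s≢t with adj? s t
      ... | yes st = st
      ... | no ¬st = ⊥-elim
        (no-apex (chain H connected s∉ t∉ s≢t ¬st a∈ (symm as) b∈ (symm bt))
          (∂A S) (∂A T) (λ v∈ → proj₂ (avoids v∈) refl) (λ v∈ → proj₁ (avoids v∈)))
      -- The other side of the separator, which contains `v`.
      D : Fin n → Set
      D y = ¬ y ∈ A.set × ¬ (∃ λ a → a ∈ A.set × Adj a y)
      nbr? : U.Decidable (λ y → ∃ λ a → a ∈ A.set × Adj a y)
      nbr? y = any? λ a → A? a ×-dec adj? a y
      D? : U.Decidable D
      D? y = ¬? (A? y) ×-dec ¬? (nbr? y)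
      boundary? : U.Decidable (Boundary H (_∈ K))
      boundary? y = ¬? (y ∈? K) ×-dec any? λ a → (a ∈? K) ×-dec adj? a y
      w∉A : ¬ w ∈ A.set
      w∉A w∈A = proj₁ (avoids w∈A) (symm wv)
      -- Common to both sides: `P` is the side kept, and `leave` puts the boundary of its part in
      -- `K` inside the clique around `A`.
      descend : ∀ {P} → (P? : U.Decidable P) → ¬ P w → ∃ (λ y → P y × y ∈ K) →
                (∀ {y y′} → P y → Adj y y′ → ¬ (P y′ × y′ ∈ K) →
                   y ∈ K → Boundary H (_∈ A.set) y′) →
                ∃ λ w → w ∈ K × Clique H (Adj w)
      descend {P} P? ¬Pw (y , Py , y∈) leave =
        let PK? = λ z → P? z ×-dec (z ∈? K)
            (x , x∈ , cl) = go ⟦ PK? ⟧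
              (rec ((λ z∈ → proj₂ (∈⟦⟧⁻ PK? z∈)) , w , w∈ , λ w∈′ → ¬Pw (proj₁ (∈⟦⟧⁻ PK? w∈′))))
              (y , ∈⟦⟧⁺ PK? (Py , y∈))
              λ S T → ∂A-clique (exit PK? S) (exit PK? T)
        in x , proj₂ (∈⟦⟧⁻ PK? x∈) , cl
        where
        exit : ∀ PK? {z} → Boundary H (_∈ ⟦ PK? ⟧) z → Boundary H (_∈ A.set) z
        exit PK? (z∉ , a , a∈ , az) =
          let (Pa , aK) = ∈⟦⟧⁻ PK? a∈ in leave Pa az (z∉ ∘ ∈⟦⟧⁺ PK?) aK
      -- The clique ∂K cannot meet both sides of the separator ∂A.
      smaller : Dec (∃ λ q → Boundary H (_∈ K) q × D q) → ∃ λ w → w ∈ K × Clique H (Adj w)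
      smaller (yes (q , q∂ , q∉A , ¬Aq)) = descend A? w∉A (u , A.root , u∈K)
        λ y∈A yz ¬z y∈K → (λ z∈A → ∂∩A ((λ z∈K → ¬z (z∈A , z∈K)) , _ , y∈K , yz) z∈A) , _ , y∈A , yz
        where
        ∂∩A : ∀ {z} → Boundary H (_∈ K) z → ¬ z ∈ A.set
        ∂∩A z∂ z∈A = ¬Aq (_ , z∈A , ∂K z∂ q∂ λ { refl → q∉A z∈A })
        u∈K : u ∈ K
        u∈K = decidable-stable (u ∈? K) λ u∉ → ∂∩A (u∉ , w , w∈ , wu) A.root
      smaller (no ∂∩D) = descend D? (λ (_ , ¬Aw) → ¬Aw (u , A.root , symm wu)) (v , Dv , v∈K)
        λ {y} {z} Dy yz ¬z y∈K →
          (λ z∈A → proj₂ Dy (z , z∈A , symm yz)) ,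
          decidable-stable (nbr? z) λ ¬Az →
            let Dz = (λ z∈A → proj₂ Dy (z , z∈A , symm yz)) , ¬Az
            in ∂∩D (z , ((λ z∈K → ¬z (Dz , z∈K)) , y , y∈K , yz) , Dz)
        where
        Dv : D v
        Dv = (λ v∈A → proj₂ (avoids v∈A) refl) , λ (a , a∈ , av) → proj₁ (avoids a∈) (symm av)
        v∈K : v ∈ K
        v∈K = decidable-stable (v ∈? K) λ v∉ → ∂∩D (v , (v∉ , w , w∈ , wv) , Dv)

-- Mountains and hills in a signed graph

successor : ∀ (i : Fin k) → NotLast i → ∃ λ j → Next i j
successor i i<k = fromℕ< i<k , toℕ-fromℕ< i<k

predecessor : ∀ (i : Fin k) → NotFirst i → ∃ λ j → Next j i
predecessor (suc i) _ = inject₁ i , cong suc (sym (toℕ-inject₁ i))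

pullback : SignedGraph n → (Fin m → Fin n) → SignedGraph m
pullback G f = record
  { sign        = λ i j → sign (f i) (f j)
  ; sign-symm   = λ i j → sign-symm (f i) (f j)
  ; sign-irrefl = λ i → sign-irrefl (f i)
  }
  where open SignedGraph G

pullback-induced : ∀ (G : SignedGraph n) {f : Fin m → Fin n} → Injective _≡_ _≡_ f →
                   SignedInducedIn (pullback G f) G
pullback-induced G {f} f-inj = record { embed = f ; injective = f-inj ; sign≡ = λ _ _ → refl }

induced-trans : ∀ {F : SignedGraph k} {H : SignedGraph m} {G : SignedGraph n} →
                SignedInducedIn F H → SignedInducedIn H G → SignedInducedIn F G
induced-trans p q = record
  { embed     = Q.embed ∘ P.embed
  ; injective = P.injective ∘ Q.injective
  ; sign≡     = λ i j → trans (Q.sign≡ _ _) (P.sign≡ i j)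
  }
  where
  module P = SignedInducedIn p
  module Q = SignedInducedIn q

module _ (G : SignedGraph n) where
  open SignedGraph G

  E-sym : ∀ {σ u v} → E σ u v → E σ v u
  E-sym {u = u} {v} = trans (sign-symm v u)

  E-unique : ∀ {σ τ u v} → E σ u v → E τ u v → σ ≡ τ
  E-unique p q = just-injective (trans (sym p) q)

  E⇒≢ : ∀ {σ u v} → E σ u v → u ≢ v
  E⇒≢ {σ} {u} e refl = Graph.irrefl (part σ) u e

  E-split : ∀ {σ τ u v w} → σ ≢ τ → E σ u v → E τ u w → v ≢ w
  E-split σ≢τ p q refl = σ≢τ (E-unique p q)

  private
    -- (C3) speaks of signed graphs on some `Fin m`, while mountains and hills are found as families
    -- of vertices of `G` indexed by a sum type. This transports edges between the two.
    module Listing {X : Set} (enum : X ↔ Fin m) (g : X → Fin n) (g-inj : Injective _≡_ _≡_ g) where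
      open Inverse enum using (to; from; strictlyInverseˡ; strictlyInverseʳ)

      graph : SignedGraph m
      graph = pullback G (g ∘ from)

      induced : SignedInducedIn graph G
      induced = pullback-induced G λ {i} {j} e →
        trans (sym (strictlyInverseˡ i)) (trans (cong to (g-inj e)) (strictlyInverseˡ j))

      sign-to : ∀ x y → SignedGraph.sign graph (to x) (to y) ≡ sign (g x) (g y)
      sign-to x y = cong₂ sign (cong g (strictlyInverseʳ x)) (cong g (strictlyInverseʳ y))

      E⁺ : ∀ {σ} x y → E σ (g x) (g y) → SignedGraph.E graph σ (to x) (to y)
      E⁺ x y = trans (sign-to x y)

      Joined⁻ : ∀ x y → SignedGraph.Joined graph (to x) (to y) → Joined (g x) (g y)
      Joined⁻ x y (σ , e) = σ , trans (sym (sign-to x y)) e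

  module _ (c3 : C3 G) {σ : Sign} {len : ℕ} {v : Fin len → Fin n}
    (inj       : ∀ {i j} → v i ≡ v j → i ≡ j)
    (path      : ∀ i j → Next i j → E (opposite σ) (v i) (v j))
    (path-only : ∀ i j → Joined (v i) (v j) → Next i j ⊎ Next j i)
    where

    no-mountain : 3 ≤ len → (w : Fin n) → (∀ i → w ≢ v i) →
                  (∀ i → NotFirst i → NotLast i → E σ w (v i)) →
                  (∀ i → Joined w (v i) → NotFirst i × NotLast i) → ⊥
    no-mountain 3≤len w w∉ w-edge w-only = proj₁ (c3 graph induced) record
      { σ = σ ; len = len ; 3≤len = 3≤len ; enum = enum
      ; path      = λ i j e → E⁺ (inj₁ i) (inj₁ j) (path i j e)
      ; path-only = λ i j → path-only i j ∘ Joined⁻ (inj₁ i) (inj₁ j)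
      ; w-edge    = λ i p q → E⁺ (inj₂ tt) (inj₁ i) (w-edge i p q)
      ; w-only    = λ i → w-only i ∘ Joined⁻ (inj₂ tt) (inj₁ i)
      }
      where
      g : Fin len ⊎ ⊤ → Fin n
      g = [ v , (λ _ → w) ]′
      g-inj : Injective _≡_ _≡_ g
      g-inj {inj₁ i} {inj₁ j} e = cong inj₁ (inj e)
      g-inj {inj₁ i} {inj₂ _} e = contradiction (sym e) (w∉ i)
      g-inj {inj₂ _} {inj₁ j} e = contradiction e (w∉ j)
      g-inj {inj₂ _} {inj₂ _} e = refl
      enum : (Fin len ⊎ ⊤) ↔ Fin (len ℕ.+ 1)
      enum = ↔-sym ((↔-id (Fin len) ⊎-↔ 1↔⊤) ↔-∘ +↔⊎)
      open Listing enum g g-inj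

    no-hill : 2 ≤ len → (w₁ w₂ : Fin n) → (∀ i → w₁ ≢ v i) → (∀ i → w₂ ≢ v i) →
              E σ w₁ w₂ →
              (∀ i → NotLast i → E σ w₁ (v i)) → (∀ i → Joined w₁ (v i) → NotLast i) →
              (∀ i → NotFirst i → E σ w₂ (v i)) → (∀ i → Joined w₂ (v i) → NotFirst i) → ⊥
    no-hill 2≤len w₁ w₂ w₁∉ w₂∉ w₁w₂ w₁-edge w₁-only w₂-edge w₂-only =
      proj₂ (c3 graph induced) record
      { σ = σ ; len = len ; 2≤len = 2≤len ; enum = enum
      ; path      = λ i j e → E⁺ (inj₁ i) (inj₁ j) (path i j e)
      ; path-only = λ i j → path-only i j ∘ Joined⁻ (inj₁ i) (inj₁ j)
      ; w₁w₂-edge = E⁺ (inj₂ 0F) (inj₂ 1F) w₁w₂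
      ; w₁-edge   = λ i p → E⁺ (inj₂ 0F) (inj₁ i) (w₁-edge i p)
      ; w₁-only   = λ i → w₁-only i ∘ Joined⁻ (inj₂ 0F) (inj₁ i)
      ; w₂-edge   = λ i p → E⁺ (inj₂ 1F) (inj₁ i) (w₂-edge i p)
      ; w₂-only   = λ i → w₂-only i ∘ Joined⁻ (inj₂ 1F) (inj₁ i)
      }
      where
      g : Fin len ⊎ Fin 2 → Fin n
      g (inj₁ i)  = v i
      g (inj₂ 0F) = w₁
      g (inj₂ 1F) = w₂
      g-inj : Injective _≡_ _≡_ g
      g-inj {inj₁ i}  {inj₁ j}  e = cong inj₁ (inj e)
      g-inj {inj₁ i}  {inj₂ 0F} e = contradiction (sym e) (w₁∉ i)
      g-inj {inj₁ i}  {inj₂ 1F} e = contradiction (sym e) (w₂∉ i)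
      g-inj {inj₂ 0F} {inj₁ j}  e = contradiction e (w₁∉ j)
      g-inj {inj₂ 1F} {inj₁ j}  e = contradiction e (w₂∉ j)
      g-inj {inj₂ 0F} {inj₂ 0F} e = refl
      g-inj {inj₂ 0F} {inj₂ 1F} e = contradiction e (E⇒≢ w₁w₂)
      g-inj {inj₂ 1F} {inj₂ 0F} e = contradiction (sym e) (E⇒≢ w₁w₂)
      g-inj {inj₂ 1F} {inj₂ 1F} e = refl
      enum : (Fin len ⊎ Fin 2) ↔ Fin (len ℕ.+ 2)
      enum = ↔-sym +↔⊎
      open Listing enum g g-inj

-- A pair of opposite signs is mostly passed as `σ ≢ τ`, which can be reversed without meeting a
-- double `opposite`; this recovers the form in the definitions.
≢⇒opposite : ∀ {σ τ} → σ ≢ τ → τ ≡ opposite σ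
≢⇒opposite {Sign.+} {Sign.+} p = contradiction refl p
≢⇒opposite {Sign.+} {Sign.-} p = refl
≢⇒opposite {Sign.-} {Sign.+} p = refl
≢⇒opposite {Sign.-} {Sign.-} p = contradiction refl p

-- Nested neighbourhoods

module _ (G : SignedGraph n) where
  open SignedGraph G

  private
    variable
      σ τ : Sign
      x y : Fin n

  N⊆ : Sign → Fin n → Fin n → Set
  N⊆ σ x y = ∀ z → E σ x z → E σ y z

  N⊆? : ∀ σ x y → Dec (N⊆ σ x y)
  N⊆? σ x y = all? λ z → adj? x z →-dec adj? y z
    where open Graph (part σ)

  N⊈ : ¬ N⊆ σ x y → ∃ λ z → E σ x z × ¬ E σ y z
  N⊈ {σ} {x} {y} ¬⊆ with ¬∀⟶∃¬ _ _ (λ z → adj? x z →-dec adj? y z) ¬⊆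
    where open Graph (part σ)
  ... | z , p = z , decidable-stable (adj? x z) (λ ¬xz → p λ xz → contradiction xz ¬xz)
                  , λ yz → p λ _ → yz
    where open Graph (part σ)

  -- Such a set K is a local maximum of N σ along τ-edges. A shortest path
  -- between nonadjacent boundary vertices through K would have a strictly
  -- larger N σ inside than at its ends, which gives a mountain or a hill.
  record Plateau (σ τ : Sign) (K : Fin n → Set) : Set where
    field
      signs     : σ ≢ τ
      connected : Connected (part τ) K
      constant  : ∀ {a b} → K a → K b → N⊆ σ a b
      summit    : ∀ {a b} → K a → ¬ K b → E τ a b → N⊆ σ b a × ¬ N⊆ σ a b

-- Consequences of (C2)

module _ (G : SignedGraph n) (c2 : C2 G) where
  open SignedGraph G

  private
    variable
      σ τ : Sign
      b c x y : Fin n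

    sym-E : E σ x y → E σ y x
    sym-E = E-sym G

  -- Edges of different signs at a common vertex have different far ends, so of the distinctness in
  -- (C2) only `u ≢ x` remains to be assumed.
  alternating : σ ≢ τ → ∀ {u v w x} → u ≢ x → E σ u v → E τ v w → E σ w x →
                (E σ u w × E σ u x) ⊎ (E σ u x × E σ v x)
  alternating σ≢τ {u} {v} {w} {x} u≢x uv vw wx with refl ← ≢⇒opposite σ≢τ =
    c2 _ u v w x
      ((E⇒≢ G uv ∷ E-split G σ≢τ (sym-E uv) vw ∷ u≢x ∷ [])
        ∷ (E⇒≢ G vw ∷ E-split G (σ≢τ ∘ sym) (sym-E vw) wx ∷ [])
        ∷ (E⇒≢ G wx ∷ []) ∷ [] ∷ [])
      uv vw wx

  -- Both alternatives of (C2) for the path `y`, `b`, `c`, `x` contain the edge between its ends.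
  joined : σ ≢ τ → E τ b c → E σ b y → E σ c x → y ≢ x → E σ y x
  joined σ≢τ bc by cx y≢x with alternating σ≢τ y≢x (sym-E by) bc cx
  ... | inj₁ (_ , e) = e
  ... | inj₂ (e , _) = e

  -- Let `y` be a σ-neighbour of `b` but not of `c`. For each σ-neighbour `x` of `c`, the path `y`,
  -- `b`, `c`, `x` alternates; the first alternative of (C2) would join `y` to `c`, so the second
  -- holds and joins `b` to `x`.
  nested : σ ≢ τ → E τ b c → ¬ N⊆ G σ b c → N⊆ G σ c b
  nested {σ} {τ} {b} {c} σ≢τ bc ¬⊆ x cx with N⊈ G ¬⊆
  ... | y , by , ¬cy
    with alternating σ≢τ (λ { refl → ¬cy cx }) (sym-E by) bc cx
  ...   | inj₁ (yc , _) = contradiction (sym-E yc) ¬cy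
  ...   | inj₂ (_ , bx) = bx

-- The boundary of a plateau

module _ (G : SignedGraph n) (c2 : C2 G) (c3 : C3 G) where
  open SignedGraph G

  private
    sym-E : ∀ {σ x y} → E σ x y → E σ y x
    sym-E = E-sym G

  module _ {σ τ : Sign} {K : Fin n → Set} (P : Plateau G σ τ K) where
    open Plateau P
    open Graph (part τ) using (adj?)

    -- By constancy `b` would be its own neighbour.
    plateau-irrefl : ∀ {a b} → K a → K b → ¬ E σ a b
    plateau-irrefl Ka Kb ab = E⇒≢ G (constant Ka Kb _ ab) refl

    -- By constancy `s` would also be σ-joined to `b`, but that edge has sign τ.
    plateau-outside : ∀ {a b s} → K a → K b → E τ s b → ¬ E σ a s
    plateau-outside Ka Kb sb as = signs (E-unique G (constant Ka Kb _ as) (sym-E sb))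

    module _ {a b s t} (s∉ : ¬ K s) (t∉ : ¬ K t) (s≢t : s ≢ t) (¬st : ¬ E τ s t)
      (Ka : K a) (sa : E τ s a) (Kb : K b) (tb : E τ t b) where
      private
        open Chain (chain (part τ) connected s∉ t∉ s≢t ¬st Ka sa Kb tb)

        Place : Fin n → Set
        Place x = x ≡ s ⊎ x ≡ t ⊎ K x

        place : ∀ i → Place (v i)
        place i with position i
        ... | inj₁ p              = inj₁ (first i p)
        ... | inj₂ (inj₁ p)       = inj₂ (inj₁ (final i p))
        ... | inj₂ (inj₂ (p , q)) = inj₂ (inj₂ (interior i p q))

        -- `summit` would turn this into a σ-edge from `a` to `t`, while `t` is τ-joined to `K`.
        st∉σ : ¬ E σ s t
        st∉σ st = plateau-outside Ka Kb tb (proj₁ (summit Ka s∉ (sym-E sa)) t st)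

        -- The chain is induced in the graph of τ; with no σ-edges among its vertices it is induced
        -- in `G`.
        no-σ : ∀ {x y} → Place x → Place y → ¬ E σ x y
        no-σ (inj₁ refl)        (inj₁ refl)        e = E⇒≢ G e refl
        no-σ (inj₁ refl)        (inj₂ (inj₁ refl)) e = st∉σ e
        no-σ (inj₁ refl)        (inj₂ (inj₂ Ky))   e = plateau-outside Ky Ka sa (sym-E e)
        no-σ (inj₂ (inj₁ refl)) (inj₁ refl)        e = st∉σ (sym-E e)
        no-σ (inj₂ (inj₁ refl)) (inj₂ (inj₁ refl)) e = E⇒≢ G e refl
        no-σ (inj₂ (inj₁ refl)) (inj₂ (inj₂ Ky))   e = plateau-outside Ky Kb tb (sym-E e)
        no-σ (inj₂ (inj₂ Kx))   (inj₁ refl)        e = plateau-outside Kx Ka sa e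
        no-σ (inj₂ (inj₂ Kx))   (inj₂ (inj₁ refl)) e = plateau-outside Kx Kb tb e
        no-σ (inj₂ (inj₂ Kx))   (inj₂ (inj₂ Ky))   e = plateau-irrefl Kx Ky e

        path : ∀ i j → Next i j → E (opposite σ) (v i) (v j)
        path i j e = subst (λ ρ → E ρ (v i) (v j)) (≢⇒opposite signs) (next e)

        by-sign : ∀ {ρ x y} → E ρ x y → ¬ E σ x y → E τ x y
        by-sign {ρ} {x} {y} e ¬σ = subst (λ ρ → E ρ x y) (other ρ ¬ρ≡σ) e
          where
          ¬ρ≡σ : σ ≢ ρ
          ¬ρ≡σ refl = ¬σ e
          other : ∀ ρ → σ ≢ ρ → ρ ≡ τ
          other ρ p = trans (≢⇒opposite p) (sym (≢⇒opposite signs))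

        path-only : ∀ i j → Joined (v i) (v j) → Next i j ⊎ Next j i
        path-only i j (ρ , e) = only (by-sign e (no-σ (place i) (place j)))

        apex∉ : ∀ {z} → E σ a z → ∀ i → z ≢ v i
        apex∉ az i refl = no-σ (inj₂ (inj₂ Ka)) (place i) az

        apex-interior : ∀ {z} → E σ a z → ∀ i → NotFirst i → NotLast i → E σ z (v i)
        apex-interior az i p q = sym-E (constant Ka (interior i p q) _ az)

        -- With a τ-edge from z to v i, the alternating path v i, z, v j, v k would
        -- close to an edge between v i and v k.
        remote : ∀ {z} → E σ a z → ∀ i j k → E τ (v i) (v j) → E τ (v j) (v k) → K (v j) →
                 ¬ (Next i k ⊎ Next k i) → v i ≢ v k → ¬ E τ z (v i)
        remote az i j k ij jk Kj ¬ik i≢k zi =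
          ¬ik (only (joined G c2 (signs ∘ sym) (sym-E (constant Ka Kj _ az)) zi jk i≢k))

        -- An edge from `z` to the first vertex would have sign τ, and `remote` excludes it using
        -- positions 0, 1 and 2; position 1 is interior since `3 ≤ len`.
        ¬joined-first : ∀ {z} → E σ a z → ¬ E σ s z → ∀ i → Joined z (v i) → NotFirst i
        ¬joined-first {z} az ¬sz i (ρ , e) with toℕ i ℕ.≟ 0
        ... | no  i≢0 = ℕ.n≢0⇒n>0 i≢0
        ... | yes i≡0 = ⊥-elim (remote az i j h (next ij) (next jh)
            (interior j (subst (0 ℕ.<_) (sym j≡1) (s≤s z≤n)) (subst (ℕ._< len) (cong suc (sym j≡1)) 3≤len))
            ih (far ∘ cong toℕ ∘ inj)
            (by-sign e λ zi → ¬sz (sym-E (subst (E σ z) (first i i≡0) zi))))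
          where
          i<  : NotLast i
          i<  = subst (λ l → suc l ℕ.< len) (sym i≡0) (ℕ.<⇒≤ 3≤len)
          j = proj₁ (successor i i<)
          ij : Next i j
          ij = proj₂ (successor i i<)
          j≡1 : toℕ j ≡ 1
          j≡1 = trans ij (cong suc i≡0)
          j<  : NotLast j
          j<  = subst (λ l → suc l ℕ.< len) (sym j≡1) 3≤len
          h = proj₁ (successor j j<)
          jh : Next j h
          jh = proj₂ (successor j j<)
          h≡2 : toℕ h ≡ 2
          h≡2 = trans jh (cong suc j≡1)
          far : toℕ i ≢ toℕ h
          far i≡h with () ← trans (sym i≡0) (trans i≡h h≡2)
          ih : ¬ (Next i h ⊎ Next h i)
          ih (inj₁ p) with () ← trans (sym h≡2) (trans p (cong suc i≡0))
          ih (inj₂ p) with () ← trans (sym i≡0) p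

        -- The mirror image, with the last three positions.
        ¬joined-last : ∀ {z} → E σ a z → ¬ E σ t z → ∀ i → Joined z (v i) → NotLast i
        ¬joined-last {z} az ¬tz i (ρ , e) with suc (toℕ i) ℕ.≟ len
        ... | no  i≢l = ℕ.≤∧≢⇒< (toℕ<n i) i≢l
        ... | yes i≡l = ⊥-elim (remote az i j h (sym-E (next ji)) (sym-E (next hj))
            (interior j 0<j (subst (ℕ._≤ len) (cong suc ji) (toℕ<n i)))
            ih (far ∘ cong toℕ ∘ inj)
            (by-sign e λ zi → ¬tz (sym-E (subst (E σ z) (final i i≡l) zi))))
          where
          1<i : 1 ℕ.< toℕ i
          1<i = ℕ.s≤s⁻¹ (subst (3 ℕ.≤_) (sym i≡l) 3≤len)
          j = proj₁ (predecessor i (ℕ.<⇒≤ 1<i))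
          ji : Next j i
          ji = proj₂ (predecessor i (ℕ.<⇒≤ 1<i))
          0<j : NotFirst j
          0<j = ℕ.s≤s⁻¹ (subst (1 ℕ.<_) ji 1<i)
          h = proj₁ (predecessor j 0<j)
          hj : Next h j
          hj = proj₂ (predecessor j 0<j)
          i≡2+h : toℕ i ≡ 2 ℕ.+ toℕ h
          i≡2+h = trans ji (cong suc hj)
          far : toℕ i ≢ toℕ h
          far i≡h = ℕ.m≢1+n+m (toℕ h) (trans (sym i≡h) i≡2+h)
          ih : ¬ (Next i h ⊎ Next h i)
          ih (inj₁ p) = ℕ.m≢1+n+m (toℕ h) {2} (trans p (cong suc i≡2+h))
          ih (inj₂ p) = ℕ.1+n≢n (ℕ.suc-injective (trans (sym i≡2+h) p))

        mountain : ∀ {z} → E σ a z → ¬ E σ s z → ¬ E σ t z → ⊥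
        mountain az ¬sz ¬tz = no-mountain G c3 inj path path-only 3≤len _ (apex∉ az)
          (apex-interior az)
          λ i e → ¬joined-first az ¬sz i e , ¬joined-last az ¬tz i e

        hill : ∀ {y z} → E σ a y → E σ s y → ¬ E σ t y → E σ a z → ¬ E σ s z → E σ t z → ⊥
        hill {y} {z} ay sy ¬ty az ¬sz tz =
          no-hill G c3 inj path path-only (ℕ.<⇒≤ 3≤len) y z (apex∉ ay) (apex∉ az)
            -- The two tops are the ends of the alternating path `y`, `s`, `a`, `z`.
            (joined G c2 signs sa sy az λ { refl → ¬sz sy })
            not-last (¬joined-last ay ¬ty) not-first (¬joined-first az ¬sz)
          where
          not-last : ∀ i → NotLast i → E σ y (v i)
          not-last i q with toℕ i ℕ.≟ 0
          ... | yes i≡0 = subst (E σ y) (sym (first i i≡0)) (sym-E sy)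
          ... | no  i≢0 = apex-interior ay i (ℕ.n≢0⇒n>0 i≢0) q
          not-first : ∀ i → NotFirst i → E σ z (v i)
          not-first i p with suc (toℕ i) ℕ.≟ len
          ... | yes i≡l = subst (E σ z) (sym (final i i≡l)) (sym-E tz)
          ... | no  i≢l = apex-interior az i p (ℕ.≤∧≢⇒< (toℕ<n i) i≢l)

      -- By `summit` some σ-neighbour `z` of `K` misses `s` and some `y` misses `t`. If one of them
      -- misses both ends, it is the top of a mountain; otherwise `y` sees `s`, `z` sees `t`, and
      -- together they top a hill.
      boundary-nonadjacent : ⊥
      boundary-nonadjacent with N⊈ G (proj₂ (summit Ka s∉ (sym-E sa)))
                              | N⊈ G (proj₂ (summit Kb t∉ (sym-E tb)))
      ... | z , az , ¬sz | y , by , ¬ty with constant Kb Ka y by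
      ... | ay with Graph.adj? (part σ) t z | Graph.adj? (part σ) s y
      ... | no ¬tz | _      = mountain az ¬sz ¬tz
      ... | yes tz | no ¬sy = mountain ay ¬sy ¬ty
      ... | yes tz | yes sy = hill ay sy ¬ty az ¬sz tz

    plateau-boundary : ∀ {a b s t} → ¬ K s → ¬ K t → K a → E τ a s → K b → E τ b t →
                       s ≢ t → E τ s t
    plateau-boundary {s = s} {t} s∉ t∉ Ka as Kb bt s≢t = decidable-stable (adj? s t) λ ¬st →
      boundary-nonadjacent s∉ t∉ s≢t ¬st Ka (sym-E as) Kb (sym-E bt)

-- Vertices that can be put last

-- (E1) and (E2) for triples with `w` in last place; the order of the other vertices does not enter.
record Eliminable (G : SignedGraph n) (w : Fin n) : Set where
  open SignedGraph G
  field
    E1 : ∀ {σ u v} → u ≢ v → E σ u w → E σ w v → E σ u v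
    E2 : ∀ {σ τ u v} → σ ≢ τ → E σ u v → E τ v w → E σ u w

opposite-pairs : ∀ {σ τ σ′ τ′ : Sign} → σ ≢ τ → σ′ ≢ τ′ →
                 (σ ≡ σ′ × τ ≡ τ′) ⊎ (σ ≡ τ′ × τ ≡ σ′)
opposite-pairs {σ} {τ} {σ′} {τ′} p q with σ Sign.≟ σ′
... | yes refl = inj₁ (refl , trans (≢⇒opposite p) (sym (≢⇒opposite q)))
... | no  r    = inj₂
  ( trans (≢⇒opposite (r ∘ sym)) (sym (≢⇒opposite q))
  , trans (≢⇒opposite p) (sym (≢⇒opposite r)))

-- Existence of an eliminable vertex

module _ (G : SignedGraph n) (c1 : C1 G) (c2 : C2 G) (c3 : C3 G) where
  open SignedGraph G

  private
    variable
      σ τ : Sign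
      x y z : Fin n

    N : Sign → Fin n → Fin n → Set
    N = N⊆ G

  chordal : ∀ σ → Chordal (part σ)
  chordal Sign.+ = proj₁ c1
  chordal Sign.- = proj₂ c1

  Up : Sign → Sign → Rel (Fin n) 0ℓ
  Up σ τ x y = E τ x y × N σ x y

  up? : ∀ σ τ → Decidable (Up σ τ)
  up? σ τ x y = Graph.adj? (part τ) x y ×-dec N⊆? G σ x y

  -- The second inclusion carries the τ-neighbour `x` of `y` over to `z`. Now `y` is a σ-neighbour
  -- of `z` but not of `x`, so `nested` leaves only the upward direction.
  up-trans : σ ≢ τ → Up σ τ x y → Up τ σ y z → Up σ τ x z
  up-trans {σ} {τ} {x} {y} {z} σ≢τ (xy , _) (yz , N⊆yz) = xz , nested G c2 σ≢τ (E-sym G xz)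
    λ N⊆zx → σ≢τ (E-unique G (N⊆zx y (E-sym G yz)) xy)
    where
    xz : E τ x z
    xz = E-sym G (N⊆yz x (E-sym G xy))

  Climb : Rel (Fin n) 0ℓ
  Climb x y = Up Sign.+ Sign.- x y ⊎ Up Sign.- Sign.+ x y

  climb? : Decidable Climb
  climb? x y = up? _ _ x y ⊎-dec up? _ _ x y

  climb⁺ : σ ≢ τ → Up σ τ x y → Climb x y
  climb⁺ {Sign.+} {Sign.+} p = contradiction refl p
  climb⁺ {Sign.+} {Sign.-} p = inj₁
  climb⁺ {Sign.-} {Sign.+} p = inj₂
  climb⁺ {Sign.-} {Sign.-} p = contradiction refl p

  climb⁻ : Climb x y → ∃₂ λ σ τ → σ ≢ τ × Up σ τ x y
  climb⁻ (inj₁ u) = Sign.+ , Sign.- , (λ ()) , u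
  climb⁻ (inj₂ u) = Sign.- , Sign.+ , (λ ()) , u

  -- By up-trans, a mixed climb collapses to a climb of constant type.
  climbs : Star Climb y z → y ≡ z ⊎
           ∃₂ λ σ τ → σ ≢ τ × N σ y z × (∀ {x} → Up τ σ x y → Up τ σ x z)
  climbs ε = inj₁ refl
  climbs {y} {z} (_◅_ {j = y₁} s ss) with climb⁻ s
  ... | σ , τ , σ≢τ , u = inj₂ (σ , τ , σ≢τ , rest (climbs ss))
    where
    direct : ∀ {z} → Up σ τ y z → N σ y z × (∀ {x} → Up τ σ x y → Up τ σ x z)
    direct u = proj₂ u , λ u′ → up-trans (σ≢τ ∘ sym) u′ u
    -- If the rest has the type of the first step, the inclusions compose; if it has the opposite
    -- type, it absorbs that step into a single one from `y` to `z`.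
    rest : (y₁ ≡ z ⊎ ∃₂ λ σ τ → σ ≢ τ × N σ y₁ z × (∀ {x} → Up τ σ x y₁ → Up τ σ x z)) →
           N σ y z × (∀ {x} → Up τ σ x y → Up τ σ x z)
    rest (inj₁ refl) = direct u
    rest (inj₂ (σ′ , τ′ , p , N⊆ , absorb)) with opposite-pairs σ≢τ p
    ... | inj₁ (refl , refl) = (λ v → N⊆ v ∘ proj₂ u v) , absorb ∘ proj₂ (direct u)
    ... | inj₂ (refl , refl) = direct (absorb u)

  -- A return of the opposite type would absorb the step into a loop at `x`; one of the same type
  -- gives the reverse inclusion.
  climb-back : σ ≢ τ → Up σ τ x y → Star Climb y x → N σ y x
  climb-back σ≢τ u back with climbs back
  ... | inj₁ refl = λ _ e → e
  ... | inj₂ (σ′ , τ′ , p , N⊆ , absorb) with opposite-pairs σ≢τ p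
  ...   | inj₁ (refl , refl) = N⊆
  ...   | inj₂ (refl , refl) = contradiction refl (E⇒≢ G (proj₁ (absorb u)))

  -- (E1) asks that `w` be simplicial for both signs, and (E2) that its neighbourhood of one sign
  -- contain that of each neighbour of the other sign.
  eliminable : ∀ {w} → (∀ σ → Clique (part σ) (E σ w)) →
               (∀ {σ τ b} → σ ≢ τ → E τ w b → N σ b w) → Eliminable G w
  eliminable clique dominates = record
    { E1 = λ u≢v uw wv → clique _ (E-sym G uw) wv u≢v
    ; E2 = λ σ≢τ uv vw → E-sym G (dominates σ≢τ (E-sym G vw) _ (E-sym G uv))
    }

  private
    -- An inclusion from `x` to a neighbour would be an upward step, so by `nested` every neighbour
    -- is strictly below.
    plateau₀ : ¬ (∃ λ y → Climb x y) → σ ≢ τ → Plateau G σ τ (_≡ x)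
    plateau₀ strict σ≢τ = record
      { signs     = σ≢τ
      ; connected = λ { refl refl → ε }
      ; constant  = λ { refl refl z e → e }
      ; summit    = λ { refl _ xb → let ⊈ = λ N⊆ → strict (_ , climb⁺ σ≢τ (xb , N⊆))
                                    in nested G c2 σ≢τ xb ⊈ , ⊈ }
      }

  -- The singleton is a plateau for either choice of signs, and its boundary is the whole
  -- neighbourhood of `x` of the edge sign.
  eliminable-peak : ¬ (∃ λ y → Climb x y) → Eliminable G x
  eliminable-peak {x} strict = eliminable clique
    λ σ≢τ xb → nested G c2 σ≢τ xb λ N⊆ → strict (_ , climb⁺ σ≢τ (xb , N⊆))
    where
    clique : ∀ τ → Clique (part τ) (E τ x)
    clique τ xa xb a≢b = plateau-boundary G c2 c3
      (plateau₀ strict (Sign.s≢opposite[s] τ ∘ sym))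
      (E⇒≢ G xa ∘ sym) (E⇒≢ G xb ∘ sym) refl xa refl xb a≢b

  module _ {x : Fin n} (terminal : Terminal climb? x) where

    -- `K` collects what upward τ-steps reach from `x`. Terminality makes it a plateau, so its
    -- boundary is a τ-clique and it contains a vertex simplicial for τ.
    eliminable-above : σ ≢ τ → Up σ τ x y → ∃ (Eliminable G)
    eliminable-above {σ} {τ} {y} σ≢τ xy =
      let (w , w∈ , clique) = ∃-simplicial (part τ) (chordal τ) K.set (x , K.root)
            λ (s∉ , _ , a∈ , as) (t∉ , _ , b∈ , bt) →
              plateau-boundary G c2 c3 plateau s∉ t∉ a∈ as b∈ bt
      in w , eliminable-in-K w∈ clique
      where
      module K = Reach (reach (up? σ τ) x)
      -- Terminality passes to `y`, and the way back to `x` makes the inclusion an equality.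
      terminal-step : ∀ {x y} → Terminal climb? x → Up σ τ x y → Terminal climb? y × N σ y x
      terminal-step {x} {y} t u = (λ y↠z → t (x→y ◅ y↠z) ◅◅ (x→y ◅ ε)) , climb-back σ≢τ u (t (x→y ◅ ε))
        where
        x→y : Climb x y
        x→y = climb⁺ σ≢τ u
      level : ∀ {x a} → Terminal climb? x → Star (Up σ τ) x a → N σ x a × N σ a x
      level t ε = (λ _ e → e) , (λ _ e → e)
      level t (u ◅ us) with terminal-step t u
      ... | t′ , N⊇ with level t′ us
      ... | p , q = (λ z → p z ∘ proj₂ u z) , (λ z → N⊇ z ∘ q z)
      constant : ∀ {a b} → a ∈ K.set → b ∈ K.set → N σ a b
      constant a∈ b∈ z = proj₁ (level terminal (K.star b∈)) z ∘ proj₂ (level terminal (K.star a∈)) z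
      edge : Fin n → Fin n → Set
      edge a b = E τ a b × a ∈ K.set × b ∈ K.set
      edge-sym : ∀ {a b} → edge a b → edge b a
      edge-sym (e , p , q) = E-sym G e , q , p
      walk : ∀ {a} → a ∈ K.set → Star edge x a
      walk = Star.map (λ (u , p) → proj₁ u , p) ∘ K.walk
      -- The step to `y` gives `x` an edge inside `K`; every later vertex of a walk has the edge by
      -- which it was entered.
      neighbour : ∀ {a} → a ∈ K.set → ∃ (edge a)
      neighbour a∈ = follow (_ , proj₁ xy , K.root , K.closed K.root xy) (walk a∈)
        where
        follow : ∀ {a b} → ∃ (edge a) → Star edge a b → ∃ (edge b)
        follow p ε        = p
        follow _ (e ◅ es) = follow (_ , edge-sym e) es
      above : ∀ {a b} → a ∈ K.set → ¬ b ∈ K.set → E τ a b → ¬ N σ a b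
      above a∈ b∉ ab N⊆ = b∉ (K.closed a∈ (ab , N⊆))
      plateau : Plateau G σ τ (_∈ K.set)
      plateau = record
        { signs     = σ≢τ
        ; connected = λ a∈ b∈ → Star.reverse edge-sym (walk a∈) ◅◅ walk b∈
        ; constant  = constant
        ; summit    = λ a∈ b∉ ab → nested G c2 σ≢τ ab (above a∈ b∉ ab) , above a∈ b∉ ab
        }
      eliminable-in-K : ∀ {w} → w ∈ K.set → Clique (part τ) (E τ w) → Eliminable G w
      eliminable-in-K {w} w∈ clique-τ with neighbour w∈
      ... | w′ , ww′ , _ , w′∈ = eliminable clique dominates
        where
        -- `w′` has the same σ-neighbours as `w`, so two of them are the ends of an alternating path
        -- through `w` and `w′`.
        clique-σ : Clique (part σ) (E σ w)
        clique-σ wa wb = joined G c2 σ≢τ ww′ wa (constant w∈ w′∈ _ wb)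
        clique : ∀ ρ → Clique (part ρ) (E ρ w)
        clique ρ with opposite-pairs σ≢τ (Sign.s≢opposite[s] ρ)
        ... | inj₁ (refl , _) = clique-σ
        ... | inj₂ (_ , refl) = clique-τ
        dominates : ∀ {ρ π b} → ρ ≢ π → E π w b → N ρ b w
        dominates {b = b} ρ≢π wb with opposite-pairs σ≢τ ρ≢π
        -- `w′` is a τ-neighbour of `w` but σ-joined to `b`, so the reverse inclusion fails.
        ... | inj₂ (refl , refl) = nested G c2 ρ≢π wb λ N⊆ →
          ρ≢π (E-unique G (E-sym G (N⊆ w′ ww′)) (constant w∈ w′∈ b wb))
        ... | inj₁ (refl , refl) with b ∈? K.set
        ...   | yes b∈ = constant b∈ w∈
        ...   | no  b∉ = nested G c2 σ≢τ wb (above w∈ b∉ wb)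

  ∃-eliminable : Fin n → ∃ (Eliminable G)
  ∃-eliminable x₀ with ∃-terminal climb? x₀
  ... | x , terminal with any? (climb? x)
  ...   | no  strict  = x , eliminable-peak strict
  ...   | yes (y , s) with climb⁻ s
  ...     | σ , τ , σ≢τ , u = eliminable-above terminal σ≢τ u

-- Elimination orderings

insert-self : ∀ i j (π : Permutation m n) → insert i j π ⟨$⟩ʳ i ≡ j
insert-self i j π with i ≟ i
... | yes _  = refl
... | no i≢i = contradiction refl i≢i

punchIn? : ∀ (w u : Fin (suc n)) → u ≡ w ⊎ ∃ λ a → u ≡ punchIn w a
punchIn? w u with w ≟ u
... | yes w≡u = inj₁ (sym w≡u)
... | no  w≢u = inj₂ (_ , sym (punchIn-punchOut w≢u))

module _ {G : SignedGraph (suc n)} {w : Fin (suc n)} (elim : Eliminable G w)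
  {ν : Permutation′ n} (seo : IsSEO (pullback G (punchIn w)) ν) where
  open SignedGraph G

  private
    ν⁺ : Permutation′ (suc n)
    -- `w` receives the largest value, so any vertex below another one comes from `punchIn w`.
    ν⁺ = insert w (fromℕ n) ν

    ν⁺-punchIn : ∀ {a b} → ν⁺ ⟨$⟩ʳ punchIn w a < ν⁺ ⟨$⟩ʳ punchIn w b → ν ⟨$⟩ʳ a < ν ⟨$⟩ʳ b
    ν⁺-punchIn {a} {b} lt = ℕ.≰⇒> λ le → ℕ.<⇒≱
      (subst₂ _<_ (insert-punchIn w (fromℕ n) ν a) (insert-punchIn w (fromℕ n) ν b) lt)
      (punchIn-mono-≤ (fromℕ n) _ _ le)

    below : ∀ {u v} → ν⁺ ⟨$⟩ʳ u < v → ∃ λ a → u ≡ punchIn w a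
    below {u} {v} lt with punchIn? w u
    ... | inj₂ p    = p
    ... | inj₁ refl = contradiction (≤fromℕ v)
      (ℕ.<⇒≱ (subst (_< v) (insert-self w (fromℕ n) ν) lt))

  insert-last-isSEO : IsSEO G ν⁺
  insert-last-isSEO = record { E1 = E1 ; E2 = E2 }
    where
    E1 : ∀ u v z → Unique (u ∷ v ∷ z ∷ []) → ν⁺ ⟨$⟩ʳ u < ν⁺ ⟨$⟩ʳ z → ν⁺ ⟨$⟩ʳ v < ν⁺ ⟨$⟩ʳ z →
         ∀ σ → E σ u z → E σ z v → E σ u v
    E1 u v z uniq u<z v<z σ with punchIn? w z | below u<z | below v<z
    ... | inj₂ (c , refl) | a , refl | b , refl =
      IsSEO.E1 seo a b c (Unique.map⁻ uniq) (ν⁺-punchIn u<z) (ν⁺-punchIn v<z) σ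
    ... | inj₁ refl | _ | _ with (u≢v ∷ _) ∷ _ ← uniq = Eliminable.E1 elim u≢v
    E2 : ∀ u v z → Unique (u ∷ v ∷ z ∷ []) → ν⁺ ⟨$⟩ʳ u < ν⁺ ⟨$⟩ʳ z → ν⁺ ⟨$⟩ʳ v < ν⁺ ⟨$⟩ʳ z →
         ∀ σ → E σ u v → E (opposite σ) v z → E σ u z
    E2 u v z uniq u<z v<z σ with punchIn? w z | below u<z | below v<z
    ... | inj₂ (c , refl) | a , refl | b , refl =
      IsSEO.E2 seo a b c (Unique.map⁻ uniq) (ν⁺-punchIn u<z) (ν⁺-punchIn v<z) σ
    ... | inj₁ refl | _ | _ = Eliminable.E2 elim (Sign.s≢opposite[s] σ)

module _ {G : SignedGraph n} {f : Fin m → Fin n} (f-inj : Injective _≡_ _≡_ f) where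

  pullback-C1 : C1 G → C1 (pullback G f)
  pullback-C1 (c₊ , c₋) = restrict c₊ , restrict c₋
    where
    restrict : ∀ {σ} → Chordal (SignedGraph.part G σ) → Chordal (SignedGraph.part (pullback G f) σ)
    restrict c 3<k i = c 3<k record { injective = injective ∘ f-inj ; adj⇔ = adj⇔ }
      where open InducedIn i

  pullback-C2 : C2 G → C2 (pullback G f)
  pullback-C2 c2 σ u v w x uniq = c2 σ (f u) (f v) (f w) (f x) (Unique.map⁺ f-inj uniq)

  pullback-C3 : C3 G → C3 (pullback G f)
  pullback-C3 c3 F i = c3 F (induced-trans i (pullback-induced G f-inj))

C1-C3⇒SEO : ∀ n (G : SignedGraph n) → C1 G → C2 G → C3 G → SignedEliminable G
C1-C3⇒SEO zero    G c1 c2 c3 = Permutation.id , record { E1 = λ () ; E2 = λ () }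
C1-C3⇒SEO (suc n) G c1 c2 c3 with ∃-eliminable G c1 c2 c3 zero
... | w , elim with C1-C3⇒SEO n (pullback G (punchIn w))
                      (pullback-C1 {G = G} inj c1) (pullback-C2 {G = G} inj c2) (pullback-C3 {G = G} inj c3)
  where
  inj : ∀ {i j} → punchIn w i ≡ punchIn w j → i ≡ j
  inj = punchIn-injective w _ _
... | ν , seo = insert w (fromℕ n) ν , insert-last-isSEO elim seo

-- Necessity of the three conditions

module _ {G : SignedGraph n} (se : SignedEliminable G) where

  private
    ν : Permutation′ n
    ν = proj₁ se
    seo : IsSEO G ν
    seo = proj₂ se

  -- The vertex whose image comes latest works, as the embedding transports (E1) and (E2). The
  -- element of `Fin m` ensures that there is one.
  induced-eliminable : ∀ {H : SignedGraph m} → SignedInducedIn H G → Fin m → ∃ (Eliminable H)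
  induced-eliminable {m = suc m} {H} i _ with argmax (λ j → toℕ (ν ⟨$⟩ʳ SignedInducedIn.embed i j))
  ... | w , max = w , record { E1 = e1 ; E2 = e2 }
    where
    open SignedInducedIn i
    module G = SignedGraph G
    open SignedGraph H
    up : ∀ {σ a b} → E σ a b → G.E σ (embed a) (embed b)
    up = trans (sign≡ _ _)
    down : ∀ {σ a b} → G.E σ (embed a) (embed b) → E σ a b
    down = trans (sym (sign≡ _ _))
    under : ∀ {u} → u ≢ w → ν ⟨$⟩ʳ embed u < ν ⟨$⟩ʳ embed w
    under {u} u≢w = ℕ.≤∧≢⇒< (max u) λ e → u≢w (injective (ν-injective (toℕ-injective e)))
      where
      ν-injective : ∀ {a b} → ν ⟨$⟩ʳ a ≡ ν ⟨$⟩ʳ b → a ≡ b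
      ν-injective e = trans (sym (Permutation.inverseˡ ν))
        (trans (cong (ν ⟨$⟩ˡ_) e) (Permutation.inverseˡ ν))
    distinct : ∀ {u v} → u ≢ v → u ≢ w → v ≢ w → Unique (embed u ∷ embed v ∷ embed w ∷ [])
    distinct u≢v u≢w v≢w = Unique.map⁺ injective ((u≢v ∷ u≢w ∷ []) ∷ (v≢w ∷ []) ∷ [] ∷ [])
    e1 : ∀ {σ u v} → u ≢ v → E σ u w → E σ w v → E σ u v
    e1 u≢v uw wv = down (IsSEO.E1 seo _ _ _ (distinct u≢v u≢w v≢w) (under u≢w) (under v≢w) _ (up uw) (up wv))
      where
      u≢w = E⇒≢ H uw
      v≢w = E⇒≢ H wv ∘ sym
    e2 : ∀ {σ τ u v} → σ ≢ τ → E σ u v → E τ v w → E σ u w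
    e2 σ≢τ uv vw with refl ← ≢⇒opposite σ≢τ =
      down (IsSEO.E2 seo _ _ _ (distinct (E⇒≢ H uv) u≢w v≢w) (under u≢w) (under v≢w) _ (up uv) (up vw))
      where
      u≢w = E-split H σ≢τ (E-sym H uv) vw
      v≢w = E⇒≢ H vw

lookup-injective : ∀ {A : Set} {xs : List A} → Unique xs → ∀ {i j} → lookup xs i ≡ lookup xs j → i ≡ j
lookup-injective (_ ∷ _)   {zero}  {zero}  e = refl
lookup-injective (x∉ ∷ _)  {zero}  {suc j} e = contradiction e (All.lookup x∉ (∈-lookup j))
lookup-injective (x∉ ∷ _)  {suc i} {zero}  e = contradiction (sym e) (All.lookup x∉ (∈-lookup i))
lookup-injective (_ ∷ xs!) {suc i} {suc j} e = cong suc (lookup-injective xs! e)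

-- The two neighbours of `i` on the cycle, which contradict (E1) when `i` is last. At the first and
-- last positions one of them comes from the closing edge.
cycle-fork : (3<k : 3 ℕ.< k) → let open Graph (cycle (ℕ.<⇒≤ 3<k)) in
             ∀ i → ∃₂ λ p q → p ≢ q × Adj p i × Adj i q × ¬ Adj p q
cycle-fork {suc k} 3<k i with position i
... | inj₁ i≡0 = fromℕ k , proj₁ next , p≢q , inj₁ (inj₂ (cong suc k≡ , i≡0)) , inj₁ (inj₁ (proj₂ next)) , fork
  where
  k≡ : toℕ (fromℕ k) ≡ k
  k≡ = toℕ-fromℕ k
  next = successor i (subst (λ l → suc l ℕ.< suc k) (sym i≡0) (ℕ.≤-trans (s≤s (s≤s z≤n)) 3<k))
  q≡1 : toℕ (proj₁ next) ≡ 1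
  q≡1 = trans (proj₂ next) (cong suc i≡0)
  p≢q : fromℕ k ≢ proj₁ next
  p≢q e = ℕ.<⇒≢ (ℕ.≤-trans (s≤s (s≤s z≤n)) (ℕ.s≤s⁻¹ 3<k)) (sym (trans (sym k≡) (trans (cong toℕ e) q≡1)))
  fork : ¬ (CyclicNext (fromℕ k) (proj₁ next) ⊎ CyclicNext (proj₁ next) (fromℕ k))
  fork (inj₁ (inj₁ e))       = ℕ.<⇒≢ (ℕ.≤-trans (s≤s z≤n) (ℕ.s≤s⁻¹ 3<k))
    (sym (trans (sym k≡) (ℕ.suc-injective (trans (sym e) q≡1))))
  fork (inj₁ (inj₂ (_ , e))) with () ← trans (sym q≡1) e
  fork (inj₂ (inj₁ e))       = ℕ.<⇒≢ (ℕ.s≤s⁻¹ 3<k) (sym (trans (sym k≡) (trans e (cong suc q≡1))))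
  fork (inj₂ (inj₂ (e , _))) = ℕ.<⇒≢ (ℕ.<⇒≤ 3<k) (trans (cong suc (sym q≡1)) e)
... | inj₂ (inj₁ i≡l) = proj₁ prev , zero , p≢q , inj₁ (inj₁ (proj₂ prev)) , inj₁ (inj₂ (i≡l , refl)) , fork
  where
  i≡k : toℕ i ≡ k
  i≡k = ℕ.suc-injective i≡l
  prev = predecessor i (subst (0 ℕ.<_) (sym i≡k) (ℕ.≤-trans (s≤s z≤n) (ℕ.s≤s⁻¹ 3<k)))
  k≡1+p : k ≡ suc (toℕ (proj₁ prev))
  k≡1+p = trans (sym i≡k) (proj₂ prev)
  2≤p : 2 ≤ toℕ (proj₁ prev)
  2≤p = ℕ.s≤s⁻¹ (subst (3 ≤_) k≡1+p (ℕ.s≤s⁻¹ 3<k))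
  p≢q : proj₁ prev ≢ zero
  p≢q e = ℕ.<⇒≢ (ℕ.<⇒≤ 2≤p) (sym (cong toℕ e))
  fork : ¬ (CyclicNext (proj₁ prev) zero ⊎ CyclicNext zero (proj₁ prev))
  fork (inj₁ (inj₁ ()))
  fork (inj₁ (inj₂ (e , _))) = ℕ.1+n≢n (sym (ℕ.suc-injective (trans e (cong suc k≡1+p))))
  fork (inj₂ (inj₁ e))       = ℕ.<⇒≢ 2≤p (sym e)
  fork (inj₂ (inj₂ (_ , e))) = ℕ.<⇒≢ (ℕ.<⇒≤ 2≤p) (sym e)
... | inj₂ (inj₂ (0<i , i<k)) =
  proj₁ prev , proj₁ next , p≢q , inj₁ (inj₁ (proj₂ prev)) , inj₁ (inj₁ (proj₂ next)) , fork
  where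
  prev = predecessor i 0<i
  next = successor i i<k
  q≡2+p : toℕ (proj₁ next) ≡ 2 ℕ.+ toℕ (proj₁ prev)
  q≡2+p = trans (proj₂ next) (cong suc (proj₂ prev))
  p≢q : proj₁ prev ≢ proj₁ next
  p≢q e = ℕ.m≢1+n+m (toℕ (proj₁ prev)) (trans (cong toℕ e) q≡2+p)
  fork : ¬ (CyclicNext (proj₁ prev) (proj₁ next) ⊎ CyclicNext (proj₁ next) (proj₁ prev))
  fork (inj₁ (inj₁ e))       = ℕ.1+n≢n (ℕ.suc-injective (trans (sym q≡2+p) e))
  fork (inj₁ (inj₂ (_ , e))) with () ← trans (sym q≡2+p) e
  fork (inj₂ (inj₁ e))       = ℕ.m≢1+n+m (toℕ (proj₁ prev)) {2} (trans e (cong suc q≡2+p))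
  -- The neighbours would be 0 and 2, joined by the closing edge of a triangle.
  fork (inj₂ (inj₂ (e , p≡0))) = ℕ.<⇒≢ 3<k (trans (cong suc (sym (trans q≡2+p (cong (2 ℕ.+_) p≡0)))) e)

module _ {G : SignedGraph n} (se : SignedEliminable G) where
  open SignedGraph G

  SEO⇒chordal : ∀ σ → Chordal (part σ)
  SEO⇒chordal σ {suc _} 3<k i with induced-eliminable se (pullback-induced G injective) zero
    where open InducedIn i
  ... | w , elim with cycle-fork 3<k w
  ...   | p , q , p≢q , pw , wq , ¬pq = ¬pq (Equivalence.from (adj⇔ p q)
    (Eliminable.E1 elim p≢q (Equivalence.to (adj⇔ p w) pw) (Equivalence.to (adj⇔ w q) wq)))
    where open InducedIn i

  SEO⇒C1 : C1 G
  SEO⇒C1 = SEO⇒chordal Sign.+ , SEO⇒chordal Sign.-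

  -- One of the four vertices can be put last among them. (E2) then carries edges along the path to
  -- that vertex, twice if it is an end and once if it is inner, and (E1) supplies the remaining
  -- edge.
  SEO⇒C2 : C2 G
  SEO⇒C2 σ u v w x uniq uv vw wx
    with induced-eliminable se (pullback-induced G {lookup (u ∷ v ∷ w ∷ x ∷ [])} (lookup-injective uniq)) zero
  ... | i , elim = last i (λ a b → E1 {u = a} {v = b}) (λ a b → E2 {u = a} {v = b})
    where
    open Eliminable elim
    σ≢ : σ ≢ opposite σ
    σ≢ = Sign.s≢opposite[s] σ
    s : ∀ {ρ a b} → E ρ a b → E ρ b a
    s = E-sym G
    f : Fin 4 → Fin n
    f = lookup (u ∷ v ∷ w ∷ x ∷ [])
    -- (E1) and (E2) are passed as functions of positions, so that splitting on `i` turns `f i` into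
    -- a named vertex.
    last : ∀ i → (∀ {ρ} a b → a ≢ b → E ρ (f a) (f i) → E ρ (f i) (f b) → E ρ (f a) (f b)) →
           (∀ {ρ π} a b → ρ ≢ π → E ρ (f a) (f b) → E π (f b) (f i) → E ρ (f a) (f i)) →
           (E σ u w × E σ u x) ⊎ (E σ u x × E σ v x)
    last 0F e1 e2 = let wu = e2 2F 1F (σ≢ ∘ sym) (s vw) (s uv)
                        xu = e2 3F 2F σ≢ (s wx) wu
                    in inj₂ (s xu , e1 1F 3F (λ ()) (s uv) (s xu))
    last 1F e1 e2 = let xv = e2 3F 2F σ≢ (s wx) (s vw)
                    in inj₂ (e1 0F 3F (λ ()) uv (s xv) , s xv)
    last 2F e1 e2 = let uw = e2 0F 1F σ≢ uv vw
                    in inj₁ (uw , e1 0F 3F (λ ()) uw wx)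
    last 3F e1 e2 = let vx = e2 1F 2F (σ≢ ∘ sym) vw wx
                        ux = e2 0F 1F σ≢ uv vx
                    in inj₁ (e1 0F 2F (λ ()) ux (s wx) , ux)

∃-first : 0 ℕ.< k → ∃ λ (i : Fin k) → toℕ i ≡ 0
∃-first {suc _} _ = zero , refl

∃-last : 0 ℕ.< k → ∃ λ (i : Fin k) → suc (toℕ i) ≡ k
∃-last {suc k} _ = fromℕ k , cong suc (toℕ-fromℕ k)

module _ {H : SignedGraph m} {w : Fin m} (elim : Eliminable H w) where
  open SignedGraph H
  open Eliminable elim

  private
    -- (E1) would join its two neighbours on the path.
    ¬interior : ∀ {σ len} {v : Fin len → Fin m} →
                (∀ {i j} → v i ≡ v j → i ≡ j) →
                (∀ i j → Next i j → E (opposite σ) (v i) (v j)) →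
                (∀ i j → Joined (v i) (v j) → Next i j ⊎ Next j i) →
                ∀ i → NotFirst i → NotLast i → v i ≢ w
    ¬interior v-inj path path-only i 0<i i<l refl with predecessor i 0<i | successor i i<l
    ... | p , pi | q , iq = ¬pq (path-only p q (_ , E1 (p≢q ∘ cong toℕ ∘ v-inj) (path p i pi) (path i q iq)))
      where
      q≡2+p : toℕ q ≡ 2 ℕ.+ toℕ p
      q≡2+p = trans iq (cong suc pi)
      p≢q : toℕ p ≢ toℕ q
      p≢q e = ℕ.m≢1+n+m (toℕ p) (trans e q≡2+p)
      ¬pq : ¬ (Next p q ⊎ Next q p)
      ¬pq (inj₁ e) = ℕ.1+n≢n (ℕ.suc-injective (trans (sym q≡2+p) e))
      ¬pq (inj₂ e) = ℕ.m≢1+n+m (toℕ p) {2} (trans e (cong suc q≡2+p))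

    enum-injective : ∀ {X Y : Set} (enum : (X ⊎ Y) ↔ Fin m) {i j : X} →
                     Inverse.to enum (inj₁ i) ≡ Inverse.to enum (inj₁ j) → i ≡ j
    enum-injective enum = inj₁-injective ∘ Injection.injective (↔⇒↣ enum)

  -- If an end of the path is last, (E2) through its path neighbour joins it to the apex; if the
  -- apex is last, (E2) joins it to the first vertex. Both edges are excluded.
  eliminable⇒¬mountain : ¬ Mountain H
  eliminable⇒¬mountain M = absurd (Inverse.from enum w) (Inverse.strictlyInverseˡ enum w)
    where
    open Mountain M renaming (w to apex)
    absurd : ∀ (x : Fin len ⊎ ⊤) → Inverse.to enum x ≡ w → ⊥
    absurd (inj₁ i) refl = case position i of λ where
      (inj₁ i≡0) →
        let (j , ij) = successor i (subst (λ l → suc l ℕ.< len) (sym i≡0) (ℕ.<⇒≤ 3≤len))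
            j≡1      = trans ij (cong suc i≡0)
            wvⱼ      = w-edge j (subst (0 ℕ.<_) (sym j≡1) (s≤s z≤n))
                                (subst (λ l → suc l ℕ.< len) (sym j≡1) 3≤len)
            wvᵢ      = E2 (Sign.s≢opposite[s] σ) wvⱼ (E-sym H (path i j ij))
        in ℕ.<⇒≢ (proj₁ (w-only i (_ , wvᵢ))) (sym i≡0)
      (inj₂ (inj₁ i≡l)) →
        let 1<i      = ℕ.s≤s⁻¹ (subst (3 ≤_) (sym i≡l) 3≤len)
            (j , ji) = predecessor i (ℕ.<⇒≤ 1<i)
            wvⱼ      = w-edge j (ℕ.s≤s⁻¹ (subst (1 ℕ.<_) ji 1<i))
                                (subst (ℕ._< len) ji (toℕ<n i))
            wvᵢ      = E2 (Sign.s≢opposite[s] σ) wvⱼ (path j i ji)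
        in ℕ.<⇒≢ (proj₂ (w-only i (_ , wvᵢ))) i≡l
      (inj₂ (inj₂ (p , q))) → ¬interior (enum-injective enum) path path-only i p q refl
    absurd (inj₂ _) refl =
      let (i , i≡0) = ∃-first (ℕ.≤-trans (s≤s z≤n) 3≤len)
          (j , ij)  = successor i (subst (λ l → suc l ℕ.< len) (sym i≡0) (ℕ.<⇒≤ 3≤len))
          j≡1       = trans ij (cong suc i≡0)
          wvⱼ       = w-edge j (subst (0 ℕ.<_) (sym j≡1) (s≤s z≤n))
                               (subst (λ l → suc l ℕ.< len) (sym j≡1) 3≤len)
          vᵢw       = E2 (Sign.s≢opposite[s] σ ∘ sym) (path i j ij) (E-sym H wvⱼ)
      in ℕ.<⇒≢ (proj₁ (w-only i (_ , E-sym H vᵢw))) (sym i≡0)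

  -- As for mountains, each end of the path and the top missing it exclude one another from being
  -- last.
  eliminable⇒¬hill : ¬ Hill H
  eliminable⇒¬hill M = absurd (Inverse.from enum w) (Inverse.strictlyInverseˡ enum w)
    where
    open Hill M
    absurd : ∀ (x : Fin len ⊎ Fin 2) → Inverse.to enum x ≡ w → ⊥
    absurd (inj₁ i) refl = case position i of λ where
      (inj₁ i≡0) →
        let (j , ij) = successor i (subst (λ l → suc l ℕ.< len) (sym i≡0) 2≤len)
            w₂vⱼ     = w₂-edge j (subst (0 ℕ.<_) (sym ij) (s≤s z≤n))
            w₂vᵢ     = E2 (Sign.s≢opposite[s] σ) w₂vⱼ (E-sym H (path i j ij))
        in ℕ.<⇒≢ (w₂-only i (_ , w₂vᵢ)) (sym i≡0)
      (inj₂ (inj₁ i≡l)) →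
        let (j , ji) = predecessor i (ℕ.s≤s⁻¹ (subst (2 ≤_) (sym i≡l) 2≤len))
            w₁vⱼ     = w₁-edge j (subst (ℕ._< len) ji (toℕ<n i))
            w₁vᵢ     = E2 (Sign.s≢opposite[s] σ) w₁vⱼ (path j i ji)
        in ℕ.<⇒≢ (w₁-only i (_ , w₁vᵢ)) i≡l
      (inj₂ (inj₂ (p , q))) → ¬interior (enum-injective enum) path path-only i p q refl
    absurd (inj₂ 0F) refl =
      let (i , i≡l) = ∃-last (ℕ.<⇒≤ 2≤len)
          (j , ji)  = predecessor i (ℕ.s≤s⁻¹ (subst (2 ≤_) (sym i≡l) 2≤len))
          w₁vⱼ      = w₁-edge j (subst (ℕ._< len) ji (toℕ<n i))
          vᵢw₁      = E2 (Sign.s≢opposite[s] σ ∘ sym) (E-sym H (path j i ji)) (E-sym H w₁vⱼ)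
      in ℕ.<⇒≢ (w₁-only i (_ , E-sym H vᵢw₁)) i≡l
    absurd (inj₂ 1F) refl =
      let (i , i≡0) = ∃-first (ℕ.<⇒≤ 2≤len)
          (j , ij)  = successor i (subst (λ l → suc l ℕ.< len) (sym i≡0) 2≤len)
          w₂vⱼ      = w₂-edge j (subst (0 ℕ.<_) (sym ij) (s≤s z≤n))
          vᵢw₂      = E2 (Sign.s≢opposite[s] σ ∘ sym) (path i j ij) (E-sym H w₂vⱼ)
      in ℕ.<⇒≢ (w₂-only i (_ , E-sym H vᵢw₂)) (sym i≡0)

module _ {G : SignedGraph n} (se : SignedEliminable G) where

  SEO⇒C3 : C3 G
  SEO⇒C3 H i =
    (λ M → eliminable⇒¬mountain (proj₂ (induced-eliminable se i (Mountain.w M))) M) ,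
    (λ M → eliminable⇒¬hill (proj₂ (induced-eliminable se i (Hill.w₁ M))) M)

  SEO⇒C1-C3 : C1 G × C2 G × C3 G
  proj₁ SEO⇒C1-C3         = SEO⇒C1 se
  proj₁ (proj₂ SEO⇒C1-C3) = SEO⇒C2 se
  proj₂ (proj₂ SEO⇒C1-C3) = SEO⇒C3

theorem5p1 : ∀ (n : ℕ) (G : SignedGraph n) →
    SignedEliminable G ⇔ (C1 G × C2 G × C3 G)
theorem5p1 n G = mk⇔ SEO⇒C1-C3 λ c → C1-C3⇒SEO n G (proj₁ c) (proj₁ (proj₂ c)) (proj₂ (proj₂ c))
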